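{- Let $n$ be a positive integer and $\mathbf{k}=(k_1,\dots,k_n)$ a vector of positive integers. Then there is a polynomial $\varphi_{n,\mathbf{k}}(s)$ in $s$, of degree $\sum_{i=1}^n k_i$, such that for every positive integer $s$ \[ h_{C_{n,\mathbf{k}}}(s)=\varphi_{n,\mathbf{k}}(s)+(-1)^s\,\frac{1+(-1)^{n+1}}{2^{\,\sum_{i=1}^{n}k_i+2}} . \]
   Context: $C_{n,\mathbf{k}}$ is the circular graph on $n$ vertices $v_1,\dots,v_n$ (arranged in a cycle) in which the vertex $v_i$ carries $k_i$ self-loops. A magic labelling with magic sum $s$ assigns a nonnegative integer to each edge (including loops) so that at each vertex the labels of incident edges (each loop counted once) sum to $s$; $h_{C_{n,\mathbf{k}}}(s)$ denotes the number of such labellings. Explicitly, $h_{C_{n,\mathbf{k}}}(s)$ is the number of nonnegative integer tuples $(\alpha_{i,j}\ (1\le i\le n,\ 1\le j\le k_i);\ \beta_1,\dots,\beta_n)$ with \[ \beta_i+\sum_{j=1}^{k_i}\alpha_{i,j}+\beta_{i+1}=s\qquad(1\le i\le n), \] where $\beta_{n+1}=\beta_1$ (for $n=1$ the condition is $2\beta_1+\sum_j\alpha_{1,j}=s$). -}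

module Defs where

open import Data.Nat using (ℕ; zero; suc; _+_; _≤_; _<_; s≤s)
open import Data.Nat.Properties
  using (_≟_; ≤-trans; ≤-reflexive; m≤m+n; m≤n+m)
open import Data.Nat.DivMod using (_mod_)
open import Data.Fin using (Fin; zero; suc; toℕ)
open import Data.Fin.Properties using (all?)
open import Data.Vec using (Vec; []; _∷_; lookup; sum)
open import Data.Vec.Properties using (∷-injective)
open import Data.Vec.Relation.Unary.All using (All; []; _∷_; reduce)
open import Data.List using (List; []; _∷_; length; filter; upTo; foldr; cartesianProduct; cartesianProductWith)
open import Data.List.Membership.Propositional using (_∈_)
open import Data.List.Membership.Propositional.Properties
  using (∈-cartesianProductWith⁺; ∈-cartesianProduct⁺; ∈-upTo⁺; ∈-filter⁺; ∈-filter⁻)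
open import Data.List.Relation.Unary.Any using (here)
import Data.List.Relation.Unary.All as ListAll
open import Data.List.Relation.Unary.AllPairs using ([]; _∷_)
open import Data.List.Relation.Unary.Unique.Propositional using (Unique)
open import Data.List.Relation.Unary.Unique.Propositional.Properties
  using (cartesianProductWith⁺; cartesianProduct⁺; upTo⁺; filter⁺)
open import Data.Integer using (+_)
open import Data.Rational using (ℚ; 0ℚ; _/_)
import Data.Rational as ℚ
open import Data.Product using (_×_; _,_; proj₂)
open import Function.Bundles using (_⇔_; mk⇔)
open import Relation.Binary.PropositionalEquality using (_≡_; _≢_; refl)
open import Relation.Unary using (Decidable)

-- The vertices of C_{n,k} are Fin n.  A labelling is a pair (α , β): α holds, for each
-- vertex i, the vector of the k_i labels of its loops, and β_i is the label of
-- the cycle edge joining vertex i - 1 to vertex i (indices modulo n).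

Labelling : ∀ {n} → Vec ℕ n → Set
Labelling {n} k = All (Vec ℕ) k × Vec ℕ n

next : ∀ {n} → Fin n → Fin n
next {suc m} i = suc (toℕ i) mod suc m

-- For n = 1 the cycle edge is counted twice, giving 2 β₁ + Σⱼ α₁ⱼ.

vertexSum : ∀ {n} {k : Vec ℕ n} → Labelling k → Fin n → ℕ
vertexSum (α , β) i = lookup β i + lookup (reduce sum α) i + lookup β (next i)

IsMagic : ∀ {n} {k : Vec ℕ n} → ℕ → Labelling k → Set
IsMagic s l = ∀ i → vertexSum l i ≡ s

isMagic? : ∀ {n} {k : Vec ℕ n} s → Decidable (IsMagic {k = k} s)
isMagic? s l = all? (λ i → vertexSum l i ≟ s)

-- In a magic labelling with sum s no label exceeds s, so the magic labellings
-- are found among the finitely many labellings with labels in {0,…,s}.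

boundedVecs : ℕ → ∀ m → List (Vec ℕ m)
boundedVecs s zero    = [] ∷ []
boundedVecs s (suc m) = cartesianProductWith _∷_ (upTo (suc s)) (boundedVecs s m)

boundedLoops : ℕ → ∀ {n} (k : Vec ℕ n) → List (All (Vec ℕ) k)
boundedLoops s []      = [] ∷ []
boundedLoops s (m ∷ k) = cartesianProductWith _∷_ (boundedVecs s m) (boundedLoops s k)

magicLabellings : ∀ {n} (k : Vec ℕ n) → ℕ → List (Labelling k)
magicLabellings {n} k s =
  filter (isMagic? s) (cartesianProduct (boundedLoops s k) (boundedVecs s n))

h : ∀ {n} → Vec ℕ n → ℕ → ℕ
h k s = length (magicLabellings k s)

-- The list contains every magic labelling (with no bound on the labels)
-- exactly once, so h k s is their number.

private
  boundedVecs-unique : ∀ s m → Unique (boundedVecs s m)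
  boundedVecs-unique s zero    = ListAll.[] ∷ []
  boundedVecs-unique s (suc m) =
    cartesianProductWith⁺ _∷_ ∷-injective (upTo⁺ (suc s)) (boundedVecs-unique s m)

  boundedLoops-unique : ∀ s {n} (k : Vec ℕ n) → Unique (boundedLoops s k)
  boundedLoops-unique s []      = ListAll.[] ∷ []
  boundedLoops-unique s (m ∷ k) =
    cartesianProductWith⁺ _∷_ (λ { refl → refl , refl })
      (boundedVecs-unique s m) (boundedLoops-unique s k)

  ∈-boundedVecs : ∀ {s m} (v : Vec ℕ m) → (∀ i → lookup v i ≤ s) → v ∈ boundedVecs s m
  ∈-boundedVecs []      v≤s = here refl
  ∈-boundedVecs (x ∷ v) v≤s =
    ∈-cartesianProductWith⁺ _∷_ (∈-upTo⁺ (s≤s (v≤s zero)))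
      (∈-boundedVecs v (λ i → v≤s (suc i)))

  lookup≤sum : ∀ {m} (v : Vec ℕ m) i → lookup v i ≤ sum v
  lookup≤sum (x ∷ v) zero    = m≤m+n x (sum v)
  lookup≤sum (x ∷ v) (suc i) = ≤-trans (lookup≤sum v i) (m≤n+m (sum v) x)

  ∈-boundedLoops : ∀ {s n} {k : Vec ℕ n} (α : All (Vec ℕ) k) →
                   (∀ i → lookup (reduce sum α) i ≤ s) → α ∈ boundedLoops s k
  ∈-boundedLoops []      α≤s = here refl
  ∈-boundedLoops (v ∷ α) α≤s =
    ∈-cartesianProductWith⁺ _∷_
      (∈-boundedVecs v (λ i → ≤-trans (lookup≤sum v i) (α≤s zero)))
      (∈-boundedLoops α (λ i → α≤s (suc i)))

magicLabellings-unique : ∀ {n} (k : Vec ℕ n) s → Unique (magicLabellings k s)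
magicLabellings-unique {n} k s =
  filter⁺ (isMagic? s) (cartesianProduct⁺ (boundedLoops-unique s k) (boundedVecs-unique s n))

∈-magicLabellings : ∀ {n} (k : Vec ℕ n) s (l : Labelling k) →
                    l ∈ magicLabellings k s ⇔ IsMagic s l
∈-magicLabellings {n} k s l@(α , β) = mk⇔ (λ l∈ → proj₂ (∈-filter⁻ (isMagic? s) {xs = box} l∈)) to-list
  where
  box : List (Labelling k)
  box = cartesianProduct (boundedLoops s k) (boundedVecs s n)

  to-list : IsMagic s l → l ∈ magicLabellings k s
  to-list magic = ∈-filter⁺ (isMagic? s)
    (∈-cartesianProduct⁺
      (∈-boundedLoops α (λ i → ≤-trans
        (≤-trans (m≤n+m (lookup (reduce sum α) i) (lookup β i)) (m≤m+n _ (lookup β (next i))))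
        (≤-reflexive (magic i))))
      (∈-boundedVecs β (λ i → ≤-trans
        (≤-trans (m≤m+n (lookup β i) (lookup (reduce sum α) i)) (m≤m+n _ (lookup β (next i))))
        (≤-reflexive (magic i)))))
    magic

-- Lists of coefficients in order of increasing degree

Polynomial : Set
Polynomial = List ℚ

coeff : Polynomial → ℕ → ℚ
coeff []      _       = 0ℚ
coeff (c ∷ p) zero    = c
coeff (c ∷ p) (suc i) = coeff p i

HasDegree : Polynomial → ℕ → Set
HasDegree p d = coeff p d ≢ 0ℚ × (∀ i → d < i → coeff p i ≡ 0ℚ)

eval : Polynomial → ℚ → ℚ
eval p x = foldr (λ c r → c ℚ.+ x ℚ.* r) 0ℚ p

fromℕ : ℕ → ℚ
fromℕ m = + m / 1

{-# OPTIONS --safe #-}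

-- Replacing β by s - β at every other vertex turns the count into the trace of a
-- word in the (s + 1) × (s + 1) matrices U = [i ≤ j] and D = [i ≥ j], of length
-- Σ k, times the reversal J when n is odd: a vertex with k loops contributes the
-- matrix Uᵏ J, and J U = D J.  Two relations determine everything.  First,
-- U + D = I + (all-ones matrix), so exchanging one letter of a word costs the trace
-- of a shorter word and a sum of entries 1ᵀ W 1.  Second, a letter can be moved
-- around the trace (and is flipped on the way when n is odd).  Thus every trace is
-- reduced to the powers of D.  The sums of entries reduce in the same way to
-- 1ᵀ Dᵃ 1, a binomial coefficient.  For n even tr Dᵃ = s + 1; for n odd
-- 2 tr (Dᵃ⁺¹ J) = tr (Dᵃ J) + 1ᵀ Dᵃ 1, so that the oscillating part, which starts
-- from tr J = [s even], is halved with each letter.  Finally, if s is at least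
-- (Σ k + 2) q, then choosing all β below q already gives q ^ Σ k labellings, which
-- excludes a degree smaller than Σ k.

module Submission where

open import Defs
open import Data.Bool using (true; false; if_then_else_)
open import Data.Fin using (Fin; zero; suc; toℕ; opposite; inject₁) renaming (fromℕ to last)
open import Data.Fin.Permutation using () renaming (reverse to reversePermutation)
open import Data.Fin.Properties using (all?; toℕ<n; toℕ-injective; toℕ-fromℕ; toℕ-fromℕ<; toℕ-inject₁; opposite-involutive; opposite-prop)
open import Data.Fin.Relation.Unary.Top using (view; ‵fromℕ; ‵inject₁)
open import Data.Integer using (1ℤ; -1ℤ)
open import Data.List using (List; []; _∷_; _++_; _∷ʳ_; map; length; lookup; filter; replicate; applyUpTo; upTo; cartesianProductWith; cartesianProduct)
open import Data.List.Properties using (++-assoc; ++-identityʳ; length-++; length-map; length-replicate)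
open import Data.Nat using (ℕ; zero; suc; _+_; _*_; _∸_; _^_; _≤_; _<_; _⊔_; z≤n; s≤s; NonZero)
open import Data.Nat.Coprimality using (1-coprimeTo) renaming (sym to coprime-sym)
open import Data.Nat.DivMod using (_%_; m%n<n; m<n⇒m%n≡m; n%n≡0)
open import Data.Nat.Properties
open import Data.Nat.Tactic.RingSolver using (solve-∀)
open import Data.Product using (_×_; _,_; ∃-syntax)
open import Data.Rational using (ℚ; mkℚ; 0ℚ; 1ℚ; ½; _/_)
open import Data.Rational.Solver using (module +-*-Solver)
open import Data.Sum using (_⊎_; inj₁; inj₂)
open import Data.Vec using (Vec; []; _∷_; sum)
open import Data.Vec.Relation.Unary.All using (All; []; _∷_; reduce)
open import Function using (_∘_; id)
open import Level using (Level)
open import Relation.Binary.Definitions using (tri<; tri≈; tri>)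
open import Relation.Binary.PropositionalEquality hiding ([_])
open import Relation.Nullary using (Dec; yes; no; does; ¬_; contradiction; _because_)
open import Relation.Nullary.Decidable using (dec-true; dec-false; _×-dec_)
open import Relation.Unary using (Pred; Decidable)
import Data.Integer as ℤ
import Data.Integer.Properties as ℤₚ
import Data.Rational as ℚ
import Data.Rational.Properties as ℚₚ
import Data.Rational.Unnormalised as ℚᵘ
import Data.Rational.Unnormalised.Properties as ℚᵘₚ
import Data.Vec as Vec
open import Algebra.Properties.Group ℚₚ.+-0-group using () renaming (⁻¹-involutive to neg-involutive)
open import Algebra.Properties.Semiring.Sum +-*-semiring renaming (sum to ∑)

private variable
  N m n d e : ℕ
  f g : ℕ → ℚ
  a b : Level
  X Y Z : Set a
  P Q : Set a

-- Iverson brackets and finite sums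

[_] : Dec P → ℕ
[ P? ] = if does P? then 1 else 0

[]-yes : (P? : Dec P) → P → [ P? ] ≡ 1
[]-yes P? p rewrite dec-true P? p = refl

[]-no : (P? : Dec P) → ¬ P → [ P? ] ≡ 0
[]-no P? ¬p rewrite dec-false P? ¬p = refl

[]-cong : (P? : Dec P) (Q? : Dec Q) → (P → Q) → (Q → P) → [ P? ] ≡ [ Q? ]
[]-cong P? (yes q) f g = []-yes P? (g q)
[]-cong P? (no ¬q) f g = []-no P? (¬q ∘ f)

[]-× : (P? : Dec P) (Q? : Dec Q) → [ P? ×-dec Q? ] ≡ [ P? ] * [ Q? ]
[]-× (true  because _) Q? = sym (*-identityˡ [ Q? ])
[]-× (false because _) Q? = refl

[]-all? : {P : Pred (Fin (suc n)) a} (P? : Decidable P) →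
          [ all? P? ] ≡ [ P? zero ] * [ all? (P? ∘ suc) ]
[]-all? P? = trans
  ([]-cong (all? P?) (P? zero ×-dec all? (P? ∘ suc))
    (λ p → p zero , p ∘ suc) (λ { (p , q) zero → p ; (p , q) (suc i) → q i }))
  ([]-× (P? zero) (all? (P? ∘ suc)))

∑-zero : (f : Fin N → ℕ) → (∀ i → f i ≡ 0) → ∑ f ≡ 0
∑-zero {N} f f≡0 = trans (sum-cong-≗ f≡0) (sum-replicate-zero N)

∑-δ : (i : Fin N) (f : Fin N → ℕ) → ∑[ l < N ] ([ toℕ i ≟ toℕ l ] * f l) ≡ f i
∑-δ {suc N} zero f =
  trans (cong₂ _+_ (*-identityˡ (f zero)) (∑-zero {N} _ (λ _ → refl))) (+-identityʳ (f zero))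
∑-δ (suc i)      f = ∑-δ i (f ∘ suc)

-- The last hypothesis covers an index `c` out of range: no term of the sum matches it then, so
-- `f c` has to be zero.
∑-δ-toℕ : ∀ N c (f : ℕ → ℕ) → (N ≤ c → f c ≡ 0) → ∑[ l < N ] ([ c ≟ toℕ l ] * f (toℕ l)) ≡ f c
∑-δ-toℕ zero    c       f out = sym (out z≤n)
∑-δ-toℕ (suc N) zero    f out =
  trans (cong₂ _+_ (*-identityˡ (f 0)) (∑-zero {N} _ (λ _ → refl))) (+-identityʳ (f 0))
∑-δ-toℕ (suc N) (suc c) f out = ∑-δ-toℕ N c (f ∘ suc) (out ∘ s≤s)

∑-opposite : (f : Fin N → ℕ) → ∑ f ≡ ∑ (f ∘ opposite)
∑-opposite f = sum-permute f reversePermutation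

∑-*-∑ : (f : Fin m → ℕ) (g : Fin n → ℕ) → ∑[ i < m ] ∑[ j < n ] (f i * g j) ≡ ∑ f * ∑ g
∑-*-∑ f g = trans (sum-cong-≗ (λ i → sym (*-distribˡ-sum (f i) g))) (sym (*-distribʳ-sum (∑ g) f))

-- Both ends are included and the last term is split off, so that Pascal's rule for `multichoose`
-- holds by definition.
prefixSum : (ℕ → ℕ) → ℕ → ℕ
prefixSum g zero    = g 0
prefixSum g (suc t) = prefixSum g t + g (suc t)

prefixSum-front : ∀ g t → prefixSum g (suc t) ≡ g 0 + prefixSum (g ∘ suc) t
prefixSum-front g zero    = refl
prefixSum-front g (suc t) =
  trans (cong (_+ g (2 + t)) (prefixSum-front g t)) (+-assoc (g 0) _ _)

∑-prefix : ∀ {N t} (g : ℕ → ℕ) → t < N →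
           ∑[ l < N ] ([ toℕ l ≤? t ] * g (toℕ l)) ≡ prefixSum g t
∑-prefix {suc N} {zero}  g (s≤s z≤n) =
  trans (cong₂ _+_ (*-identityˡ (g 0)) (∑-zero {N} _ (λ _ → refl))) (+-identityʳ (g 0))
∑-prefix {suc N} {suc t} g (s≤s t<N) = begin
  1 * g 0 + ∑[ l < N ] ([ suc (toℕ l) ≤? suc t ] * g (suc (toℕ l)))
    ≡⟨ cong₂ _+_ (*-identityˡ (g 0)) (sum-cong-≗ {N} λ l → cong (_* g (suc (toℕ l)))
         ([]-cong (suc (toℕ l) ≤? suc t) (toℕ l ≤? t) ≤-pred s≤s)) ⟩
  g 0 + ∑[ l < N ] ([ toℕ l ≤? t ] * g (suc (toℕ l)))
    ≡⟨ cong (g 0 +_) (∑-prefix (g ∘ suc) t<N) ⟩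
  g 0 + prefixSum (g ∘ suc) t ≡⟨ prefixSum-front g t ⟨
  prefixSum g (suc t) ∎
  where open ≡-Reasoning

∑-toℕ : ∀ s (g : ℕ → ℕ) → ∑[ i ≤ s ] g (toℕ i) ≡ prefixSum g s
∑-toℕ zero    g = +-identityʳ (g 0)
∑-toℕ (suc s) g = trans (cong (g 0 +_) (∑-toℕ s (g ∘ suc))) (sym (prefixSum-front g s))

-- Terms outside the `q` consecutive indices from `c` on are dropped. The lower bounds for matrix
-- entries are built by nesting such windows.
∑-window : ∀ {N} (f : Fin N → ℕ) c q v → c + q ≤ N →
           (∀ l → c ≤ toℕ l → toℕ l < c + q → v ≤ f l) → q * v ≤ ∑ f
∑-window f       zero    zero    v c+q≤N v≤f = z≤n
∑-window f       zero    (suc q) v (s≤s q≤N) v≤f =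
  +-mono-≤ (v≤f zero z≤n (s≤s z≤n)) (∑-window (f ∘ suc) 0 q v q≤N (λ l _ l<q → v≤f (suc l) z≤n (s≤s l<q)))
∑-window f       (suc c) q       v (s≤s c+q≤N) v≤f =
  ≤-trans (∑-window (f ∘ suc) c q v c+q≤N (λ l c≤l l<c+q → v≤f (suc l) (s≤s c≤l) (s≤s l<c+q)))
          (m≤n+m _ (f zero))

-- Words in the matrices of ≤ and ≥

data Step : Set where
  up down : Step

flip : Step → Step
flip up   = down
flip down = up

Word : Set
Word = List Step

Matrix : ℕ → Set
Matrix N = Fin N → Fin N → ℕ

infixr 7 _⊗_
_⊗_ : Matrix N → Matrix N → Matrix N
_⊗_ {N} X Y i j = ∑[ l < N ] (X i l * Y l j)

1ᴹ : Matrix N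
1ᴹ i j = [ toℕ i ≟ toℕ j ]

step : Step → Matrix N
step up   i j = [ toℕ i ≤? toℕ j ]
step down i j = [ toℕ j ≤? toℕ i ]

mat : Word → Matrix N
mat []      = 1ᴹ
mat (x ∷ w) = step x ⊗ mat w

total : ℕ → Word → ℕ
total N w = ∑[ i < N ] ∑[ j < N ] mat w i j

-- The permutation of the `n`-th power of the reversal J. It stays an iterate, not reduced modulo 2,
-- so that `n` can be the length of the cycle.
reflect : ℕ → Fin N → Fin N
reflect zero    i = i
reflect (suc n) i = opposite (reflect n i)

-- The trace of W Jⁿ, where W is the matrix of the word.
twistedTrace : ℕ → ℕ → Word → ℕ
twistedTrace N n w = ∑[ i < N ] mat w i (reflect n i)

⊗-congʳ : (X : Matrix N) {Y Z : Matrix N} → (∀ i j → Y i j ≡ Z i j) → ∀ i j → (X ⊗ Y) i j ≡ (X ⊗ Z) i j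
⊗-congʳ X Y≡Z i j = sum-cong-≗ (λ l → cong (X i l *_) (Y≡Z l j))

⊗-identityˡ : (X : Matrix N) → ∀ i j → (1ᴹ ⊗ X) i j ≡ X i j
⊗-identityˡ X i j = ∑-δ i (λ l → X l j)

⊗-identityʳ : (X : Matrix N) → ∀ i j → (X ⊗ 1ᴹ) i j ≡ X i j
⊗-identityʳ X i j = trans
  (sum-cong-≗ λ l → trans (*-comm (X i l) _) (cong (_* X i l) ([]-cong (toℕ l ≟ toℕ j) (toℕ j ≟ toℕ l) sym sym)))
  (∑-δ j (X i))

⊗-assoc : (X Y Z : Matrix N) → ∀ i j → ((X ⊗ Y) ⊗ Z) i j ≡ (X ⊗ (Y ⊗ Z)) i j
⊗-assoc {N} X Y Z i j = begin
  ∑[ l < N ] (∑[ k < N ] (X i k * Y k l) * Z l j)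
    ≡⟨ sum-cong-≗ (λ l → *-distribʳ-sum (Z l j) (λ k → X i k * Y k l)) ⟩
  ∑[ l < N ] ∑[ k < N ] (X i k * Y k l * Z l j)
    ≡⟨ ∑-comm (λ l k → X i k * Y k l * Z l j) ⟩
  ∑[ k < N ] ∑[ l < N ] (X i k * Y k l * Z l j)
    ≡⟨ sum-cong-≗ (λ k → trans (sum-cong-≗ λ l → *-assoc (X i k) (Y k l) (Z l j))
                                (sym (*-distribˡ-sum (X i k) (λ l → Y k l * Z l j)))) ⟩
  ∑[ k < N ] (X i k * ∑[ l < N ] (Y k l * Z l j)) ∎
  where open ≡-Reasoning

mat-++ : ∀ u w (i j : Fin N) → mat (u ++ w) i j ≡ (mat u ⊗ mat w) i j
mat-++ []      w i j = sym (⊗-identityˡ (mat w) i j)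
mat-++ (x ∷ u) w i j = trans (⊗-congʳ (step x) (mat-++ u w) i j) (sym (⊗-assoc (step x) (mat u) (mat w) i j))

-- Distinct indices are comparable in exactly one direction and equal ones in both, so the diagonal
-- is the excess over the all-ones matrix.
step-flip : ∀ x (i j : Fin N) → step x i j + step (flip x) i j ≡ 1ᴹ i j + 1
step-flip up i j with <-cmp (toℕ i) (toℕ j)
... | tri< i<j i≢j i≯j
  rewrite []-yes (toℕ i ≤? toℕ j) (<⇒≤ i<j) | []-no (toℕ j ≤? toℕ i) (<⇒≱ i<j) | []-no (toℕ i ≟ toℕ j) i≢j = refl
... | tri≈ i≮j i≡j i≯j
  rewrite []-yes (toℕ i ≤? toℕ j) (≤-reflexive i≡j) | []-yes (toℕ j ≤? toℕ i) (≤-reflexive (sym i≡j)) | []-yes (toℕ i ≟ toℕ j) i≡j = refl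
... | tri> i≮j i≢j i>j
  rewrite []-no (toℕ i ≤? toℕ j) (<⇒≱ i>j) | []-yes (toℕ j ≤? toℕ i) (<⇒≤ i>j) | []-no (toℕ i ≟ toℕ j) i≢j = refl
step-flip down i j = trans (+-comm (step down i j) (step up i j)) (step-flip up i j)

-- The all-ones part of `step-flip` replaces row `i` of `mat w` by the column sums, which do not
-- depend on `i`.
mat-flip : ∀ x w (i j : Fin N) →
           mat (x ∷ w) i j + mat (flip x ∷ w) i j ≡ mat w i j + ∑[ l < N ] mat w l j
mat-flip {N} x w i j = begin
  mat (x ∷ w) i j + mat (flip x ∷ w) i j
    ≡⟨ ∑-distrib-+ {N} (λ l → step x i l * mat w l j) (λ l → step (flip x) i l * mat w l j) ⟨
  ∑[ l < N ] (step x i l * mat w l j + step (flip x) i l * mat w l j)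
    ≡⟨ sum-cong-≗ {N} (λ l → trans (sym (*-distribʳ-+ (mat w l j) (step x i l) (step (flip x) i l)))
         (trans (cong (_* mat w l j) (step-flip x i l)) (*-distribʳ-+ (mat w l j) (1ᴹ i l) 1))) ⟩
  ∑[ l < N ] (1ᴹ i l * mat w l j + 1 * mat w l j)
    ≡⟨ ∑-distrib-+ {N} (λ l → 1ᴹ i l * mat w l j) (λ l → 1 * mat w l j) ⟩
  (1ᴹ ⊗ mat w) i j + ∑[ l < N ] (1 * mat w l j)
    ≡⟨ cong₂ _+_ (⊗-identityˡ (mat w) i j) (sum-cong-≗ {N} (λ l → *-identityˡ (mat w l j))) ⟩
  mat w i j + ∑[ l < N ] mat w l j ∎
  where open ≡-Reasoning

∑-reflect : ∀ n (f : Fin N → ℕ) → ∑ f ≡ ∑ (f ∘ reflect n)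
∑-reflect zero    f = refl
∑-reflect (suc n) f = trans (∑-opposite f) (∑-reflect n (f ∘ opposite))

twistedTrace-flip : ∀ N n x w →
  twistedTrace N n (x ∷ w) + twistedTrace N n (flip x ∷ w) ≡ twistedTrace N n w + total N w
twistedTrace-flip N n x w = begin
  twistedTrace N n (x ∷ w) + twistedTrace N n (flip x ∷ w)
    ≡⟨ ∑-distrib-+ {N} _ _ ⟨
  ∑[ i < N ] (mat (x ∷ w) i (reflect n i) + mat (flip x ∷ w) i (reflect n i))
    ≡⟨ sum-cong-≗ {N} (λ i → mat-flip x w i (reflect n i)) ⟩
  ∑[ i < N ] (mat w i (reflect n i) + ∑[ l < N ] mat w l (reflect n i))
    ≡⟨ ∑-distrib-+ {N} (λ i → mat w i (reflect n i)) (λ i → ∑[ l < N ] mat w l (reflect n i)) ⟩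
  twistedTrace N n w + ∑[ i < N ] ∑[ l < N ] mat w l (reflect n i)
    -- `reflect n` only permutes the columns, so each column sum is counted once.
    ≡⟨ cong (twistedTrace N n w +_) (trans
         (sym (∑-reflect {N} n (λ j → ∑[ l < N ] mat w l j))) (∑-comm {N} (λ j l → mat w l j))) ⟩
  twistedTrace N n w + total N w ∎
  where open ≡-Reasoning

-- Reversal of the indices and rotation of the trace

opposite-mono-≤ : {i j : Fin N} → toℕ i ≤ toℕ j → toℕ (opposite j) ≤ toℕ (opposite i)
opposite-mono-≤ {N} {i} {j} i≤j
  rewrite opposite-prop i | opposite-prop j = ∸-monoʳ-≤ N (s≤s i≤j)

opposite-mirror-≤ : (i j : Fin N) → toℕ (opposite i) ≤ toℕ j → toℕ (opposite j) ≤ toℕ i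
opposite-mirror-≤ i j p = subst (λ z → toℕ (opposite j) ≤ toℕ z) (opposite-involutive i) (opposite-mono-≤ p)

opposite-mirror-≥ : (i j : Fin N) → toℕ i ≤ toℕ (opposite j) → toℕ j ≤ toℕ (opposite i)
opposite-mirror-≥ i j p = subst (λ z → toℕ z ≤ toℕ (opposite i)) (opposite-involutive j) (opposite-mono-≤ p)

step-opposite : ∀ x (i j : Fin N) → step x (opposite i) j ≡ step (flip x) i (opposite j)
step-opposite up   i j = []-cong (toℕ (opposite i) ≤? toℕ j) (toℕ (opposite j) ≤? toℕ i)
  (opposite-mirror-≤ i j) (opposite-mirror-≤ j i)
step-opposite down i j = []-cong (toℕ j ≤? toℕ (opposite i)) (toℕ i ≤? toℕ (opposite j))
  (opposite-mirror-≥ j i) (opposite-mirror-≥ i j)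

flips : ℕ → Step → Step
flips zero    x = x
flips (suc n) x = flips n (flip x)

flips-flip : ∀ n x → flips n (flip x) ≡ flip (flips n x)
flips-flip zero    x = refl
flips-flip (suc n) x = flips-flip n (flip x)

reflect-opposite : ∀ n (i : Fin N) → reflect n (opposite i) ≡ opposite (reflect n i)
reflect-opposite zero    i = refl
reflect-opposite (suc n) i = cong opposite (reflect-opposite n i)

-- Moving Jⁿ past a letter uses J U = D J or J D = U J once for each factor, so the letter comes out
-- flipped `n` times.
step-reflect : ∀ n x (i j : Fin N) → step x (reflect n i) j ≡ step (flips n x) i (reflect n j)
step-reflect zero    x i j = refl
step-reflect (suc n) x i j = begin
  step x (opposite (reflect n i)) j               ≡⟨ step-opposite x (reflect n i) j ⟩
  step (flip x) (reflect n i) (opposite j)        ≡⟨ step-reflect n (flip x) i (opposite j) ⟩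
  step (flips n (flip x)) i (reflect n (opposite j)) ≡⟨ cong (step (flips n (flip x)) i) (reflect-opposite n j) ⟩
  step (flips n (flip x)) i (opposite (reflect n j)) ∎
  where open ≡-Reasoning

reflect-involutive : ∀ n (i : Fin N) → reflect n (reflect n i) ≡ i
reflect-involutive zero    i = refl
reflect-involutive (suc n) i = trans (cong opposite (reflect-opposite n (reflect n i)))
  (trans (opposite-involutive _) (reflect-involutive n i))

-- Cyclicity of the trace carries the letter to the far side of Jⁿ, and `step-reflect` brings it
-- back across.
twistedTrace-rotate : ∀ N n x w → twistedTrace N n (x ∷ w) ≡ twistedTrace N n (w ∷ʳ flips n x)
twistedTrace-rotate N n x w = begin
  ∑[ i < N ] ∑[ l < N ] (step x i l * mat w l (reflect n i))
    ≡⟨ ∑-reflect {N} n _ ⟩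
  ∑[ i < N ] ∑[ l < N ] (step x (reflect n i) l * mat w l (reflect n (reflect n i)))
    ≡⟨ sum-cong-≗ {N} (λ i → sum-cong-≗ {N} λ l → trans
         (cong₂ _*_ (step-reflect n x i l) (cong (mat w l) (reflect-involutive n i)))
         (*-comm _ (mat w l i))) ⟩
  ∑[ i < N ] ∑[ l < N ] (mat w l i * step (flips n x) i (reflect n l))
    ≡⟨ ∑-comm {N} (λ i l → mat w l i * step (flips n x) i (reflect n l)) ⟩
  ∑[ l < N ] (mat w ⊗ step (flips n x)) l (reflect n l)
    ≡⟨ sum-cong-≗ {N} (λ l → trans
         (⊗-congʳ (mat w) (λ i j → sym (⊗-identityʳ (step (flips n x)) i j)) l (reflect n l))
         (sym (mat-++ w (flips n x ∷ []) l (reflect n l)))) ⟩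
  twistedTrace N n (w ∷ʳ flips n x) ∎
  where open ≡-Reasoning

-- The all-ones matrix is a column of ones times a row of ones, so inserting it between `u` and `w`
-- splits the sum of entries into a product.
total-flip : ∀ N u x w →
  total N (u ++ x ∷ w) + total N (u ++ flip x ∷ w) ≡
  total N (u ++ w) + total N u * total N w
total-flip N u x w = begin
  total N (u ++ x ∷ w) + total N (u ++ flip x ∷ w)
    ≡⟨ cong₂ _+_ (expand (x ∷ w)) (expand (flip x ∷ w)) ⟩
  ∑[ l < N ] (col l * row (x ∷ w) l) + ∑[ l < N ] (col l * row (flip x ∷ w) l)
    ≡⟨ ∑-distrib-+ {N} _ _ ⟨
  ∑[ l < N ] (col l * row (x ∷ w) l + col l * row (flip x ∷ w) l)
    ≡⟨ sum-cong-≗ {N} (λ l → trans (sym (*-distribˡ-+ (col l) (row (x ∷ w) l) (row (flip x ∷ w) l)))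
         (trans (cong (col l *_) (row-flip l)) (*-distribˡ-+ (col l) (row w l) _))) ⟩
  ∑[ l < N ] (col l * row w l + col l * total N w)
    ≡⟨ ∑-distrib-+ {N} (λ l → col l * row w l) (λ l → col l * total N w) ⟩
  ∑[ l < N ] (col l * row w l) + ∑[ l < N ] (col l * total N w)
    ≡⟨ cong₂ _+_ (sym (expand w)) (trans (sym (*-distribʳ-sum (total N w) col))
         (cong (_* total N w) (∑-comm {N} (λ l i → mat u i l)))) ⟩
  total N (u ++ w) + total N u * total N w ∎
  where
  open ≡-Reasoning
  col : Fin N → ℕ
  col l = ∑[ i < N ] mat u i l
  row : Word → Fin N → ℕ
  row v l = ∑[ j < N ] mat v l j
  expand : ∀ v → total N (u ++ v) ≡ ∑[ l < N ] (col l * row v l)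
  expand v = begin
    ∑[ i < N ] ∑[ j < N ] mat (u ++ v) i j
      ≡⟨ sum-cong-≗ {N} (λ i → sum-cong-≗ {N} (mat-++ u v i)) ⟩
    ∑[ i < N ] ∑[ j < N ] ∑[ l < N ] (mat u i l * mat v l j)
      ≡⟨ sum-cong-≗ {N} (λ i → ∑-comm {N} (λ j l → mat u i l * mat v l j)) ⟩
    ∑[ i < N ] ∑[ l < N ] ∑[ j < N ] (mat u i l * mat v l j)
      ≡⟨ ∑-comm {N} (λ i l → ∑[ j < N ] (mat u i l * mat v l j)) ⟩
    ∑[ l < N ] ∑[ i < N ] ∑[ j < N ] (mat u i l * mat v l j)
      ≡⟨ sum-cong-≗ {N} (λ l → ∑-*-∑ (λ i → mat u i l) (mat v l)) ⟩
    ∑[ l < N ] (col l * row v l) ∎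
  row-flip : ∀ l → row (x ∷ w) l + row (flip x ∷ w) l ≡ row w l + total N w
  row-flip l = begin
    row (x ∷ w) l + row (flip x ∷ w) l ≡⟨ ∑-distrib-+ {N} _ _ ⟨
    ∑[ j < N ] (mat (x ∷ w) l j + mat (flip x ∷ w) l j) ≡⟨ sum-cong-≗ {N} (mat-flip x w l) ⟩
    ∑[ j < N ] (mat w l j + ∑[ k < N ] mat w k j) ≡⟨ ∑-distrib-+ {N} (mat w l) (λ j → ∑[ k < N ] mat w k j) ⟩
    row w l + ∑[ j < N ] ∑[ k < N ] mat w k j ≡⟨ cong (row w l +_) (∑-comm {N} (λ j k → mat w k j)) ⟩
    row w l + total N w ∎

ups : ℕ → Word
ups k = replicate k up

-- Powers of D

-- The binomial coefficient (t + a choose a), as an iterated prefix sum.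
multichoose : ℕ → ℕ → ℕ
multichoose zero    t = 1
multichoose (suc a) t = prefixSum (multichoose a) t

-- Absorption identities for binomial coefficients, kept free of division. They are proved by one
-- simultaneous induction: Pascal's rule reduces the first at `suc t`, and the second at `suc a`, to
-- both of them at `a` and `t`.
multichoose-absorb : ∀ a t → suc a * multichoose (suc a) t ≡ suc (t + a) * multichoose a t
multichoose-shift  : ∀ a t → suc (t + a) * multichoose a t ≡ suc t * multichoose a (suc t)

multichoose-absorb a zero    = refl
multichoose-absorb a (suc t) = begin
  suc a * (M + M′)                   ≡⟨ *-distribˡ-+ (suc a) M M′ ⟩
  suc a * M + suc a * M′             ≡⟨ cong (_+ suc a * M′) (trans (multichoose-absorb a t) (multichoose-shift a t)) ⟩
  suc t * M′ + suc a * M′            ≡⟨ *-distribʳ-+ M′ (suc t) (suc a) ⟨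
  (suc t + suc a) * M′               ≡⟨ cong (_* M′) (cong suc (+-suc t a)) ⟩
  suc (suc t + a) * M′ ∎
  where
  open ≡-Reasoning
  M  = multichoose (suc a) t
  M′ = multichoose a (suc t)

multichoose-shift zero    t = cong (_* 1) (cong suc (+-identityʳ t))
multichoose-shift (suc a) t = begin
  suc (t + suc a) * M        ≡⟨ *-distribʳ-+ M (suc t) (suc a) ⟩
  suc t * M + suc a * M      ≡⟨ cong (suc t * M +_) (trans (multichoose-absorb a t) (multichoose-shift a t)) ⟩
  suc t * M + suc t * M′     ≡⟨ *-distribˡ-+ (suc t) M M′ ⟨
  suc t * (M + M′) ∎
  where
  open ≡-Reasoning
  M  = multichoose (suc a) t
  M′ = multichoose a (suc t)

downs : ℕ → Word
downs a = replicate a down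

-- Multiplying a column vector by D takes its prefix sums, which is the recursion of `multichoose`.
∑-mat-downs : ∀ a (i : Fin N) → ∑[ j < N ] mat (downs a) i j ≡ multichoose a (toℕ i)
∑-mat-downs {N} zero    i = trans
  (sum-cong-≗ {N} (λ j → sym (*-identityʳ (1ᴹ i j)))) (∑-δ i (λ _ → 1))
∑-mat-downs {N} (suc a) i = begin
  ∑[ j < N ] ∑[ l < N ] (step down i l * mat (downs a) l j)
    ≡⟨ ∑-comm {N} (λ j l → step down i l * mat (downs a) l j) ⟩
  ∑[ l < N ] ∑[ j < N ] (step down i l * mat (downs a) l j)
    ≡⟨ sum-cong-≗ {N} (λ l → trans (sym (*-distribˡ-sum (step down i l) (mat (downs a) l)))
         (cong (step down i l *_) (∑-mat-downs a l))) ⟩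
  ∑[ l < N ] (step down i l * multichoose a (toℕ l))
    ≡⟨ ∑-prefix (multichoose a) (toℕ<n i) ⟩
  multichoose (suc a) (toℕ i) ∎
  where open ≡-Reasoning

total-downs : ∀ a s → total (suc s) (downs a) ≡ multichoose (suc a) s
total-downs a s = trans (sum-cong-≗ {suc s} (∑-mat-downs a)) (∑-toℕ s (multichoose a))

mat-downs-triangular : ∀ a (i j : Fin N) → toℕ i < toℕ j → mat (downs a) i j ≡ 0
mat-downs-triangular zero    i j i<j = []-no (toℕ i ≟ toℕ j) (<⇒≢ i<j)
mat-downs-triangular (suc a) i j i<j = ∑-zero _ vanish
  where
  vanish : ∀ l → step down i l * mat (downs a) l j ≡ 0
  vanish l with toℕ l ≤? toℕ i
  ... | yes l≤i = trans (cong (step down i l *_) (mat-downs-triangular a l j (≤-<-trans l≤i i<j))) (*-zeroʳ (step down i l))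
  ... | no  l≰i = cong (_* mat (downs a) l j) ([]-no (toℕ l ≤? toℕ i) l≰i)

-- Both factors of the product are lower triangular, so only the term `l` = `i` survives.
mat-downs-diagonal : ∀ a (i : Fin N) → mat (downs a) i i ≡ 1
mat-downs-diagonal zero    i = []-yes (toℕ i ≟ toℕ i) refl
mat-downs-diagonal {N} (suc a) i = trans (sum-cong-≗ {N} δ) (∑-δ i (λ _ → 1))
  where
  δ : ∀ l → step down i l * mat (downs a) l i ≡ 1ᴹ i l * 1
  δ l with <-cmp (toℕ l) (toℕ i)
  ... | tri< l<i l≢i _ rewrite mat-downs-triangular a l i l<i | []-no (toℕ i ≟ toℕ l) (l≢i ∘ sym) = *-zeroʳ (step down i l)
  ... | tri≈ _ l≡i _ rewrite toℕ-injective l≡i | mat-downs-diagonal a i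
                           | []-yes (toℕ i ≟ toℕ i) refl | []-yes (toℕ i ≤? toℕ i) ≤-refl = refl
  ... | tri> l≰i l≢i i<l rewrite []-no (toℕ l ≤? toℕ i) (<⇒≱ i<l) | []-no (toℕ i ≟ toℕ l) (l≢i ∘ sym) = refl

trace-downs : ∀ N a → twistedTrace N 0 (downs a) ≡ N
trace-downs N a = trans (sum-cong-≗ {N} (mat-downs-diagonal a)) (∑-one N)
  where
  ∑-one : ∀ N → ∑[ i < N ] 1 ≡ N
  ∑-one zero    = refl
  ∑-one (suc N) = cong suc (∑-one N)

replicate-∷ʳ : ∀ {A : Set} a (x : A) → replicate a x ∷ʳ x ≡ replicate (suc a) x
replicate-∷ʳ zero    x = refl
replicate-∷ʳ (suc a) x = cong (x ∷_) (replicate-∷ʳ a x)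

-- With a single reversal a leading `up` rotates to a trailing `down`. The two words exchanged by
-- `twistedTrace-flip` therefore have the same trace.
trace-reflect-downs : ∀ N a → twistedTrace N 1 (downs (suc a)) + twistedTrace N 1 (downs (suc a)) ≡
                              twistedTrace N 1 (downs a) + total N (downs a)
trace-reflect-downs N a = trans
  (cong (twistedTrace N 1 (downs (suc a)) +_)
    (sym (trans (twistedTrace-rotate N 1 up (downs a)) (cong (twistedTrace N 1) (replicate-∷ʳ a down)))))
  (twistedTrace-flip N 1 down (downs a))

isEven : ℕ → ℕ
isEven zero          = 1
isEven (suc zero)    = 0
isEven (suc (suc s)) = isEven s

∑-halves : ∀ N s → s < N * 2 → ∑[ i < N ] [ toℕ i * 2 ≟ s ] ≡ isEven s
∑-halves (suc N) zero          _   = cong suc (∑-zero {N} _ (λ _ → refl))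
∑-halves (suc N) (suc zero)    _   = ∑-zero {N} _ (λ _ → refl)
∑-halves (suc N) (suc (suc s)) s<N = ∑-halves N s (≤-pred (≤-pred s<N))

-- The trace of J counts the fixed points of i ↦ s - i, the solutions of 2 i = s.
trace-reflect-[] : ∀ s → twistedTrace (suc s) 1 [] ≡ isEven s
trace-reflect-[] s = trans
  (sum-cong-≗ {suc s} (λ i → trans (cong (λ z → [ toℕ i ≟ z ]) (opposite-prop i)) (mid (toℕ i) (≤-pred (toℕ<n i)))))
  (∑-halves (suc s) s (s≤s (≤-trans (m≤m*n s 2) (n≤1+n (s * 2)))))
  where
  double : ∀ i → i * 2 ≡ i + i
  double = solve-∀
  mid : ∀ i → i ≤ s → [ i ≟ s ∸ i ] ≡ [ i * 2 ≟ s ]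
  mid i i≤s = []-cong (i ≟ s ∸ i) (i * 2 ≟ s)
    (λ eq → trans (double i) (trans (cong (i +_) eq) (m+[n∸m]≡n i≤s)))
    (λ eq → sym (trans (cong (_∸ i) (trans (sym eq) (double i))) (m+n∸m≡n i i)))

twistedTrace-period : ∀ N n w → twistedTrace N (2 + n) w ≡ twistedTrace N n w
twistedTrace-period N n w = sum-cong-≗ {N} (λ i → cong (mat w i) (opposite-involutive (reflect n i)))

-- Labellings as entries of matrix products

-- The sum runs over positions in the list, so that `∑-comm` also exchanges it with sums over matrix
-- indices.
∑∈ : List X → (X → ℕ) → ℕ
∑∈ xs f = ∑[ i < length xs ] f (lookup xs i)

∑∈-filter : {P : Pred X a} (P? : Decidable P) (xs : List X) → length (filter P? xs) ≡ ∑∈ xs (λ x → [ P? x ])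
∑∈-filter P? []       = refl
∑∈-filter P? (x ∷ xs) with does (P? x)
... | true  = cong suc (∑∈-filter P? xs)
... | false = ∑∈-filter P? xs

∑∈-++ : (xs ys : List X) (f : X → ℕ) → ∑∈ (xs ++ ys) f ≡ ∑∈ xs f + ∑∈ ys f
∑∈-++ []       ys f = refl
∑∈-++ (x ∷ xs) ys f = trans (cong (f x +_) (∑∈-++ xs ys f)) (sym (+-assoc (f x) _ _))

∑∈-map : (g : X → Y) (xs : List X) (f : Y → ℕ) → ∑∈ (map g xs) f ≡ ∑∈ xs (f ∘ g)
∑∈-map g []       f = refl
∑∈-map g (x ∷ xs) f = cong (f (g x) +_) (∑∈-map g xs f)

∑∈-cartesianProductWith : (_∙_ : X → Y → Z) (xs : List X) (ys : List Y) (f : Z → ℕ) →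
  ∑∈ (cartesianProductWith _∙_ xs ys) f ≡ ∑∈ xs (λ x → ∑∈ ys (λ y → f (x ∙ y)))
∑∈-cartesianProductWith _∙_ []       ys f = refl
∑∈-cartesianProductWith _∙_ (x ∷ xs) ys f = trans
  (∑∈-++ (map (x ∙_) ys) _ f)
  (cong₂ _+_ (∑∈-map (x ∙_) ys f) (∑∈-cartesianProductWith _∙_ xs ys f))

∑∈-applyUpTo : (g : ℕ → X) (n : ℕ) (f : X → ℕ) → ∑∈ (applyUpTo g n) f ≡ ∑[ i < n ] f (g (toℕ i))
∑∈-applyUpTo g zero    f = refl
∑∈-applyUpTo g (suc n) f = cong (f (g 0) +_) (∑∈-applyUpTo (g ∘ suc) n f)

∑∈-cong : (xs : List X) {f g : X → ℕ} → (∀ x → f x ≡ g x) → ∑∈ xs f ≡ ∑∈ xs g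
∑∈-cong xs f≡g = sum-cong-≗ (f≡g ∘ lookup xs)

∑∈-boundedVecs : ∀ s m (f : Vec ℕ (suc m) → ℕ) →
  ∑∈ (boundedVecs s (suc m)) f ≡ ∑[ x ≤ s ] ∑∈ (boundedVecs s m) (λ v → f (toℕ x ∷ v))
∑∈-boundedVecs s m f = trans
  (∑∈-cartesianProductWith _∷_ (upTo (suc s)) (boundedVecs s m) f)
  (∑∈-applyUpTo id (suc s) (λ x → ∑∈ (boundedVecs s m) (λ v → f (x ∷ v))))

-- The only candidate for `x` is l - i, which is below `N` because `l` is.
∑-shift : ∀ {N} (i l : Fin N) → ∑[ x < N ] [ toℕ i + toℕ x ≟ toℕ l ] ≡ step up i l
∑-shift {N} i l = shift (toℕ i) (toℕ<n l)
  where
  shift : ∀ i {l} → l < N → ∑[ x < N ] [ i + toℕ x ≟ l ] ≡ [ i ≤? l ]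
  shift zero    {l}     l<N = trans
    (sum-cong-≗ {N} (λ x → trans ([]-cong (toℕ x ≟ l) (l ≟ toℕ x) sym sym) (sym (*-identityʳ [ l ≟ toℕ x ]))))
    (∑-δ-toℕ N l (λ _ → 1) (λ N≤l → contradiction l<N (≤⇒≯ N≤l)))
  shift (suc i) {zero}  l<N = ∑-zero {N} _ (λ _ → refl)
  shift (suc i) {suc l} l<N = trans (shift i (<⇒≤ l<N)) ([]-cong (i ≤? l) (suc i ≤? suc l) s≤s ≤-pred)

-- A value `c` beyond the index range contributes to neither side, since `c + y` cannot be an index
-- then.
∑-compose : ∀ {N} c y (j : Fin N) → ∑[ l < N ] ([ c ≟ toℕ l ] * [ toℕ l + y ≟ toℕ j ]) ≡ [ c + y ≟ toℕ j ]
∑-compose {N} c y j = ∑-δ-toℕ N c (λ l → [ l + y ≟ toℕ j ])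
  (λ N≤c → []-no (c + y ≟ toℕ j) (λ eq → <⇒≱ (toℕ<n j) (≤-trans N≤c (≤-trans (m≤m+n c y) (≤-reflexive eq)))))

-- A product of `k` factors U counts weakly increasing chains from `i` to `j`; the increments of the
-- chain are the entries of `v`.
mat-ups : ∀ s k (i j : Fin (suc s)) →
          mat (ups k) i j ≡ ∑∈ (boundedVecs s k) (λ v → [ toℕ i + sum v ≟ toℕ j ])
mat-ups s zero    i j = sym (trans (+-identityʳ _) (cong (λ z → [ z ≟ toℕ j ]) (+-identityʳ (toℕ i))))
mat-ups s (suc k) i j = begin
  ∑[ l ≤ s ] (step up i l * mat (ups k) l j)
    ≡⟨ sum-cong-≗ {suc s} (λ l → trans (cong₂ _*_ (sym (∑-shift i l)) (mat-ups s k l j))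
         (sym (∑-*-∑ {suc s} {length V} (λ x → [ toℕ i + toℕ x ≟ toℕ l ])
           (λ v → [ toℕ l + sum (lookup V v) ≟ toℕ j ])))) ⟩
  ∑[ l ≤ s ] ∑[ x ≤ s ] ∑∈ V (λ v → [ toℕ i + toℕ x ≟ toℕ l ] * [ toℕ l + sum v ≟ toℕ j ])
    ≡⟨ ∑-comm {suc s} {suc s} (λ l x → ∑∈ V (λ v → [ toℕ i + toℕ x ≟ toℕ l ] * [ toℕ l + sum v ≟ toℕ j ])) ⟩
  ∑[ x ≤ s ] ∑[ l ≤ s ] ∑∈ V (λ v → [ toℕ i + toℕ x ≟ toℕ l ] * [ toℕ l + sum v ≟ toℕ j ])
    ≡⟨ sum-cong-≗ {suc s} (λ x → trans
         (∑-comm {suc s} {length V} (λ l v → [ toℕ i + toℕ x ≟ toℕ l ] * [ toℕ l + sum (lookup V v) ≟ toℕ j ]))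
         (∑∈-cong V (λ v → trans (∑-compose (toℕ i + toℕ x) (sum v) j)
           (cong (λ z → [ z ≟ toℕ j ]) (+-assoc (toℕ i) (toℕ x) (sum v)))))) ⟩
  ∑[ x ≤ s ] ∑∈ V (λ v → [ toℕ i + (toℕ x + sum v) ≟ toℕ j ])
    ≡⟨ ∑∈-boundedVecs s k (λ v → [ toℕ i + sum v ≟ toℕ j ]) ⟨
  ∑∈ (boundedVecs s (suc k)) (λ v → [ toℕ i + sum v ≟ toℕ j ]) ∎
  where
  open ≡-Reasoning
  V = boundedVecs s k

-- The entry at (b, b′) counts the loop labels at a vertex of magic sum s = N - 1
-- whose two cycle edges are labelled b and b′.
vertexMatrix : ℕ → Matrix N
vertexMatrix k i j = mat (ups k) i (opposite j)

vertexMatrix-count : ∀ s k (i j : Fin (suc s)) →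
  vertexMatrix k i j ≡ ∑∈ (boundedVecs s k) (λ v → [ toℕ i + sum v + toℕ j ≟ s ])
vertexMatrix-count s k i j = trans (mat-ups s k i (opposite j)) (∑∈-cong (boundedVecs s k) eq)
  where
  j≤s : toℕ j ≤ s
  j≤s = ≤-pred (toℕ<n j)
  eq : ∀ v → [ toℕ i + sum v ≟ toℕ (opposite j) ] ≡ [ toℕ i + sum v + toℕ j ≟ s ]
  eq v rewrite opposite-prop j = []-cong (toℕ i + sum v ≟ s ∸ toℕ j) (toℕ i + sum v + toℕ j ≟ s)
    (λ e → trans (cong (_+ toℕ j) e) (m∸n+n≡m j≤s))
    (λ e → sym (trans (cong (_∸ toℕ j) (sym e)) (m+n∸n≡m (toℕ i + sum v) (toℕ j))))

transfer : Vec ℕ n → Matrix N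
transfer []       = 1ᴹ
transfer (k ∷ ks) = vertexMatrix k ⊗ transfer ks

-- The cycle is cut open at its first edge: `b` and `c` label the two ends, and `γ` labels the edges
-- in between.
weight : ∀ s {m} {k : Vec ℕ (suc m)} → All (Vec ℕ) k → ℕ → Vec ℕ m → ℕ → ℕ
weight s (v ∷ [])          b []       c = [ b + sum v + c ≟ s ]
weight s (v ∷ α@(_ ∷ _)) b (b′ ∷ γ) c = [ b + sum v + b′ ≟ s ] * weight s α b′ γ c

-- Once the inner edge labels are fixed, the loop labels of different vertices are independent;
-- summing over the inner labels is then matrix multiplication.
transfer-count : ∀ s {m} (k : Vec ℕ (suc m)) (i j : Fin (suc s)) →
  ∑∈ (boundedLoops s k) (λ α → ∑∈ (boundedVecs s m) (λ γ → weight s α (toℕ i) γ (toℕ j))) ≡ transfer k i j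
transfer-count s (k ∷ []) i j = begin
  -- With one vertex the sum over `γ` has the empty vector as its only index, which leaves the
  -- `+ 0`.
  ∑∈ (boundedLoops s (k ∷ [])) (λ α → weight s α (toℕ i) [] (toℕ j) + 0)
    ≡⟨ ∑∈-cartesianProductWith _∷_ (boundedVecs s k) ([] ∷ []) (λ α → weight s α (toℕ i) [] (toℕ j) + 0) ⟩
  ∑∈ (boundedVecs s k) (λ v → c v + 0 + 0)
    ≡⟨ ∑∈-cong (boundedVecs s k) {λ v → c v + 0 + 0} {c} (λ v → trans (+-identityʳ (c v + 0)) (+-identityʳ (c v))) ⟩
  ∑∈ (boundedVecs s k) c
    ≡⟨ vertexMatrix-count s k i j ⟨
  vertexMatrix k i j ≡⟨ ⊗-identityʳ (vertexMatrix k) i j ⟨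
  transfer (k ∷ []) i j ∎
  where
  open ≡-Reasoning
  c : Vec ℕ k → ℕ
  c v = [ toℕ i + sum v + toℕ j ≟ s ]
transfer-count s {suc m} (k ∷ ks@(_ ∷ _)) i j = begin
  ∑∈ (boundedLoops s (k ∷ ks)) (λ α → ∑∈ (boundedVecs s (suc m)) (λ γ → weight s α (toℕ i) γ (toℕ j)))
    ≡⟨ ∑∈-cartesianProductWith _∷_ V L (λ α → ∑∈ (boundedVecs s (suc m)) (λ γ → weight s α (toℕ i) γ (toℕ j))) ⟩
  ∑∈ V (λ v → ∑∈ L (λ α → ∑∈ (boundedVecs s (suc m)) (λ γ → weight s (v ∷ α) (toℕ i) γ (toℕ j))))
    ≡⟨ ∑∈-cong V (λ v → ∑∈-cong L (split v)) ⟩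
  ∑∈ V (λ v → ∑∈ L (λ α → ∑[ b ≤ s ] (c v b * W α b)))
    ≡⟨ ∑∈-cong V (λ v → ∑-comm {length L} (λ α b → c v b * W (lookup L α) b)) ⟩
  ∑∈ V (λ v → ∑[ b ≤ s ] ∑∈ L (λ α → c v b * W α b))
    ≡⟨ ∑-comm {length V} (λ v b → ∑∈ L (λ α → c (lookup V v) b * W α b)) ⟩
  ∑[ b ≤ s ] ∑∈ V (λ v → ∑∈ L (λ α → c v b * W α b))
    ≡⟨ sum-cong-≗ {suc s} (λ b → trans (∑-*-∑ {length V} {length L} (λ v → c (lookup V v) b) (λ α → W (lookup L α) b))
         (cong₂ _*_ (sym (vertexMatrix-count s k i b)) (transfer-count s ks b j))) ⟩
  transfer (k ∷ ks) i j ∎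
  where
  open ≡-Reasoning
  V = boundedVecs s k
  L = boundedLoops s ks
  c : Vec ℕ k → Fin (suc s) → ℕ
  c v b = [ toℕ i + sum v + toℕ b ≟ s ]
  W : All (Vec ℕ) ks → Fin (suc s) → ℕ
  W α b = ∑∈ (boundedVecs s m) (λ γ → weight s α (toℕ b) γ (toℕ j))
  split : ∀ v α → ∑∈ (boundedVecs s (suc m)) (λ γ → weight s (v ∷ α) (toℕ i) γ (toℕ j)) ≡ ∑[ b ≤ s ] (c v b * W α b)
  -- `weight` unfolds only once `α` is known to be nonempty.
  split v α@(_ ∷ _) = trans (∑∈-boundedVecs s m (λ γ → weight s (v ∷ α) (toℕ i) γ (toℕ j)))
    (sum-cong-≗ {suc s} (λ b → sym (*-distribˡ-sum (c v b) (λ γ → weight s α (toℕ b) (lookup (boundedVecs s m) γ) (toℕ j)))))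

-- This trades the successor modulo the length for a shifted vector: the last index wraps around to
-- `b`, and every other one moves on without reduction.
lookup-next : ∀ b (γ : Vec ℕ m) i → Vec.lookup (b ∷ γ) (next i) ≡ Vec.lookup (γ Vec.∷ʳ b) i
lookup-next {m} b γ i with view i
... | ‵fromℕ = trans (cong (Vec.lookup (b ∷ γ)) next-last) (sym (lookup-last γ))
  where
  next-last : next (last m) ≡ zero
  next-last = toℕ-injective (trans (toℕ-fromℕ< (m%n<n (suc (toℕ (last m))) (suc m)))
    (trans (cong (λ z → suc z % suc m) (toℕ-fromℕ m)) (n%n≡0 (suc m))))
  lookup-last : ∀ {m} (γ : Vec ℕ m) → Vec.lookup (γ Vec.∷ʳ b) (last m) ≡ b
  lookup-last []     = refl
  lookup-last (_ ∷ γ) = lookup-last γ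
... | ‵inject₁ j = trans (cong (Vec.lookup (b ∷ γ)) next-init) (sym (init γ j))
  where
  next-init : next (inject₁ j) ≡ suc j
  next-init = toℕ-injective (trans (toℕ-fromℕ< (m%n<n (suc (toℕ (inject₁ j))) (suc m)))
    (trans (cong (λ z → suc z % suc m) (toℕ-inject₁ j)) (m<n⇒m%n≡m (s≤s (toℕ<n j)))))
  init : ∀ {m} (γ : Vec ℕ m) j → Vec.lookup (γ Vec.∷ʳ b) (inject₁ j) ≡ Vec.lookup γ j
  init (_ ∷ γ) zero    = refl
  init (_ ∷ γ) (suc j) = init γ j

weight-all? : ∀ s {k : Vec ℕ (suc m)} (α : All (Vec ℕ) k) b γ c →
  [ all? (λ i → Vec.lookup (b ∷ γ) i + Vec.lookup (reduce sum α) i + Vec.lookup (γ Vec.∷ʳ c) i ≟ s) ] ≡ weight s α b γ c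
weight-all? s (v ∷ [])        b []       c = trans
  ([]-all? {n = 0} (λ i → Vec.lookup (b ∷ []) i + Vec.lookup (sum v ∷ []) i + Vec.lookup (c ∷ []) i ≟ s))
  (*-identityʳ [ b + sum v + c ≟ s ])
weight-all? s (v ∷ α@(_ ∷ _)) b (b′ ∷ γ) c = trans
  ([]-all? (λ i → Vec.lookup (b ∷ b′ ∷ γ) i + Vec.lookup (sum v ∷ reduce sum α) i + Vec.lookup (b′ ∷ (γ Vec.∷ʳ c)) i ≟ s))
  (cong ([ b + sum v + b′ ≟ s ] *_) (weight-all? s α b′ γ c))

weight-isMagic? : ∀ s {k : Vec ℕ (suc m)} (α : All (Vec ℕ) k) b γ →
                  [ isMagic? {k = k} s (α , b ∷ γ) ] ≡ weight s α b γ b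
weight-isMagic? s {k} α b γ = trans
  ([]-cong (isMagic? {k = k} s (α , b ∷ γ)) (all? (λ i → V i + Vec.lookup (γ Vec.∷ʳ b) i ≟ s))
    (λ p i → trans (cong (V i +_) (sym (lookup-next b γ i))) (p i))
    (λ p i → trans (cong (V i +_) (lookup-next b γ i)) (p i)))
  (weight-all? s α b γ b)
  where
  V : ∀ i → ℕ
  V i = Vec.lookup (b ∷ γ) i + Vec.lookup (reduce sum α) i

-- The label of the edge where the cycle is cut occurs at both ends of the open path, hence the
-- diagonal entries.
h≡trace-transfer : ∀ s (k : Vec ℕ (suc m)) → h k s ≡ ∑[ b ≤ s ] transfer k b b
h≡trace-transfer {m} s k = begin
  h k s
    ≡⟨ ∑∈-filter (isMagic? s) (cartesianProduct (boundedLoops s k) (boundedVecs s (suc m))) ⟩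
  ∑∈ (cartesianProduct (boundedLoops s k) (boundedVecs s (suc m))) (λ l → [ isMagic? s l ])
    ≡⟨ ∑∈-cartesianProductWith _,_ (boundedLoops s k) (boundedVecs s (suc m)) (λ l → [ isMagic? s l ]) ⟩
  ∑∈ (boundedLoops s k) (λ α → ∑∈ (boundedVecs s (suc m)) (λ β → [ isMagic? s (α , β) ]))
    ≡⟨ ∑∈-cong (boundedLoops s k) (λ α → trans (∑∈-boundedVecs s m (λ β → [ isMagic? s (α , β) ]))
         (sum-cong-≗ {suc s} (λ b → ∑∈-cong (boundedVecs s m) (weight-isMagic? s α (toℕ b))))) ⟩
  ∑∈ (boundedLoops s k) (λ α → ∑[ b ≤ s ] W α b)
    ≡⟨ ∑-comm {length (boundedLoops s k)} (λ α b → W (lookup (boundedLoops s k) α) b) ⟩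
  ∑[ b ≤ s ] ∑∈ (boundedLoops s k) (λ α → W α b)
    ≡⟨ sum-cong-≗ {suc s} (λ b → transfer-count s k b b) ⟩
  ∑[ b ≤ s ] transfer k b b ∎
  where
  open ≡-Reasoning
  W : All (Vec ℕ) k → Fin (suc s) → ℕ
  W α b = ∑∈ (boundedVecs s m) (λ γ → weight s α (toℕ b) γ (toℕ b))

-- Collecting the reversals at the end of the word

-- In the product of the matrices Uᵏ J, moving a J to the far right flips all letters after it.
word : Vec ℕ n → Word
word []       = []
word (k ∷ ks) = ups k ++ map flip (word ks)

length-word : (k : Vec ℕ n) → length (word k) ≡ sum k
length-word []       = refl
length-word (k ∷ ks) = trans (length-++ (ups k))
  (cong₂ _+_ (length-replicate k) (trans (length-map flip (word ks)) (length-word ks)))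

mat-opposite : ∀ w (i j : Fin N) → mat w (opposite i) j ≡ mat (map flip w) i (opposite j)
mat-opposite []      i j = []-cong (toℕ (opposite i) ≟ toℕ j) (toℕ i ≟ toℕ (opposite j))
  (λ e → cong toℕ (trans (sym (opposite-involutive i)) (cong opposite (toℕ-injective e))))
  (λ e → cong toℕ (trans (cong opposite (toℕ-injective e)) (opposite-involutive j)))
mat-opposite {N} (x ∷ w) i j = trans (∑-opposite {N} _)
  (sum-cong-≗ {N} (λ l → cong₂ _*_
    (trans (step-opposite x i (opposite l)) (cong (step (flip x) i) (opposite-involutive l)))
    (mat-opposite w l j)))

transfer-word : (k : Vec ℕ n) (i j : Fin N) → transfer k i j ≡ mat (word k) i (reflect n j)
transfer-word []       i j = refl
transfer-word {suc n} {N} (k ∷ ks) i j = begin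
  ∑[ l < N ] (mat (ups k) i (opposite l) * transfer ks l j)
    -- Reversing the summation index cancels the J of the vertex matrix and applies it to the
    -- remaining product instead.
    ≡⟨ ∑-opposite {N} _ ⟩
  ∑[ l < N ] (mat (ups k) i (opposite (opposite l)) * transfer ks (opposite l) j)
    ≡⟨ sum-cong-≗ {N} (λ l → cong₂ _*_ (cong (mat (ups k) i) (opposite-involutive l))
         (trans (transfer-word ks (opposite l) j) (mat-opposite (word ks) l (reflect n j)))) ⟩
  (mat (ups k) ⊗ mat (map flip (word ks))) i (reflect (suc n) j)
    ≡⟨ mat-++ (ups k) (map flip (word ks)) i (reflect (suc n) j) ⟨
  mat (word (k ∷ ks)) i (reflect (suc n) j) ∎
  where open ≡-Reasoning

h≡twistedTrace : ∀ s (k : Vec ℕ (suc m)) → h k s ≡ twistedTrace (suc s) (suc m) (word k)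
h≡twistedTrace s k = trans (h≡trace-transfer s k) (sum-cong-≗ {suc s} (λ b → transfer-word k b b))

-- A lower bound for the number of labellings

-- Each of the first `k` increments of the chain may be any number below `q`. The hypothesis keeps
-- the chain from passing `j`, and the last factor U covers the remaining distance.
mat-ups-lower : ∀ q k (i j : Fin N) → toℕ i + k * q ≤ toℕ j → q ^ k ≤ mat (ups (suc k)) i j
mat-ups-lower q zero    i j i≤j = ≤-reflexive (sym (trans (⊗-identityʳ (step up) i j)
  ([]-yes (toℕ i ≤? toℕ j) (≤-trans (m≤m+n (toℕ i) 0) i≤j))))
mat-ups-lower {N} q (suc k) i j i+q+kq≤j = ∑-window _ (toℕ i) q (q ^ k)
  (<⇒≤ (≤-<-trans (≤-trans (+-monoʳ-≤ (toℕ i) (m≤m+n q (k * q))) i+q+kq≤j) (toℕ<n j))) bound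
  where
  bound : ∀ l → toℕ i ≤ toℕ l → toℕ l < toℕ i + q → q ^ k ≤ step up i l * mat (ups (suc k)) l j
  bound l i≤l l<i+q = ≤-trans
    (mat-ups-lower q k l j (≤-trans (+-monoˡ-≤ (k * q) (<⇒≤ l<i+q))
      (≤-trans (≤-reflexive (+-assoc (toℕ i) q (k * q))) i+q+kq≤j)))
    (≤-reflexive (sym (trans (cong (_* mat (ups (suc k)) l j) ([]-yes (toℕ i ≤? toℕ l) i≤l)) (*-identityˡ _))))

-- Of the `2 + k` multiples of `q`, two bound the cycle labels and `k` bound the freely chosen
-- loops; the last loop takes what is missing from `s`.
vertexMatrix-lower : ∀ s q k (i j : Fin (suc s)) → (2 + k) * q ≤ s →
                     toℕ i < q → toℕ j < q → q ^ k ≤ vertexMatrix (suc k) i j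
vertexMatrix-lower s q k i j big i<q j<q = mat-ups-lower q k i (opposite j)
  (subst (toℕ i + k * q ≤_) (sym (opposite-prop j)) (m+n≤o⇒m≤o∸n (toℕ i + k * q) (begin
    toℕ i + k * q + toℕ j ≤⟨ +-mono-≤ (+-monoˡ-≤ (k * q) (<⇒≤ i<q)) (<⇒≤ j<q) ⟩
    q + k * q + q         ≡⟨ rearrange k q ⟩
    (2 + k) * q           ≤⟨ big ⟩
    s                     ∎)))
  where
  open ≤-Reasoning
  rearrange : ∀ k q → q + k * q + q ≡ (2 + k) * q
  rearrange = solve-∀

-- On the open path each vertex has one loop fewer than it carries to choose freely, and each inner
-- edge gives one more factor `q`: altogether one factor short of `q ^ sum k`. The `q` on the right
-- avoids a subtraction in the exponent.
transfer-lower : ∀ s q (k : Vec ℕ (suc m)) → All NonZero k → (2 + sum k) * q ≤ s →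
  (i j : Fin (suc s)) → toℕ i < q → toℕ j < q → q ^ sum k ≤ q * transfer k i j
transfer-lower s q (zero  ∷ _) (record { nonZero = () } ∷ _)
transfer-lower s q (suc k ∷ []) _ big i j i<q j<q = begin
  q ^ (suc k + 0)                    ≡⟨ cong (λ z → q ^ suc z) (+-identityʳ k) ⟩
  q * q ^ k                          ≤⟨ *-monoʳ-≤ q (vertexMatrix-lower s q k i j
                                          (≤-trans (*-monoˡ-≤ q (+-monoʳ-≤ 2 (≤-trans (n≤1+n k) (m≤m+n (suc k) 0)))) big) i<q j<q) ⟩
  q * vertexMatrix (suc k) i j       ≡⟨ cong (q *_) (⊗-identityʳ (vertexMatrix (suc k)) i j) ⟨
  q * transfer (suc k ∷ []) i j      ∎
  where open ≤-Reasoning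
transfer-lower s q (suc k ∷ ks@(_ ∷ _)) (_ ∷ ks≢0) big i j i<q j<q = begin
  q ^ (suc k + sum ks)      ≡⟨ cong (q *_) (^-distribˡ-+-* q k (sum ks)) ⟩
  q * (q ^ k * q ^ sum ks)  ≤⟨ ∑-window (λ l → q * (vertexMatrix (suc k) i l * transfer ks l j)) 0 q _ q≤1+s bound ⟩
  ∑[ l ≤ s ] (q * (vertexMatrix (suc k) i l * transfer ks l j))
    ≡⟨ *-distribˡ-sum {suc s} q (λ l → vertexMatrix (suc k) i l * transfer ks l j) ⟨
  q * transfer (suc k ∷ ks) i j ∎
  where
  open ≤-Reasoning
  q≤1+s : q ≤ suc s
  q≤1+s = ≤-trans (≤-trans (m≤n*m q (2 + (suc k + sum ks))) big) (n≤1+n s)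
  swap : ∀ a q b → a * (q * b) ≡ q * (a * b)
  swap = solve-∀
  bound : ∀ l → 0 ≤ toℕ l → toℕ l < q →
          q ^ k * q ^ sum ks ≤ q * (vertexMatrix (suc k) i l * transfer ks l j)
  bound l _ l<q = ≤-trans
    (*-mono-≤
      (vertexMatrix-lower s q k i l
        (≤-trans (*-monoˡ-≤ q (+-monoʳ-≤ 2 (≤-trans (n≤1+n k) (m≤m+n (suc k) (sum ks))))) big) i<q l<q)
      (transfer-lower s q ks ks≢0
        (≤-trans (*-monoˡ-≤ q (+-monoʳ-≤ 2 (m≤n+m (sum ks) (suc k)))) big) l j l<q j<q))
    (≤-reflexive (swap (vertexMatrix (suc k) i l) q (transfer ks l j)))

-- The diagonal index takes `q` values, which supplies the missing factor; the `q` carried along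
-- from `transfer-lower` then cancels.
h-lower : ∀ s q .{{_ : NonZero q}} (k : Vec ℕ (suc m)) → All NonZero k → (2 + sum k) * q ≤ s → q ^ sum k ≤ h k s
h-lower s q k k≢0 big = *-cancelˡ-≤ q (begin
  q * q ^ sum k
    ≤⟨ ∑-window (λ b → q * transfer k b b) 0 q (q ^ sum k)
         (≤-trans (≤-trans (m≤n*m q (2 + sum k)) big) (n≤1+n s))
         (λ b _ b<q → transfer-lower s q k k≢0 big b b b<q b<q) ⟩
  ∑[ b ≤ s ] (q * transfer k b b) ≡⟨ *-distribˡ-sum {suc s} q (λ b → transfer k b b) ⟨
  q * ∑[ b ≤ s ] transfer k b b   ≡⟨ cong (q *_) (h≡trace-transfer s k) ⟨
  q * h k s                       ∎)
  where open ≤-Reasoning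

-- Polynomials

-- For a variable `m` the division by 1 is stuck on a gcd; in this normal form sums, products and
-- comparisons reduce to those of integers.
fromℕ-mkℚ : ∀ m → fromℕ m ≡ mkℚ (ℤ.+ m) 0 (coprime-sym (1-coprimeTo m))
fromℕ-mkℚ m = ℚₚ.normalize-coprime (coprime-sym (1-coprimeTo m))

fromℕ-+ : ∀ m n → fromℕ (m + n) ≡ fromℕ m ℚ.+ fromℕ n
fromℕ-+ m n rewrite fromℕ-mkℚ m | fromℕ-mkℚ n =
  cong (_/ 1) (sym (cong₂ ℤ._+_ (ℤₚ.*-identityʳ (ℤ.+ m)) (ℤₚ.*-identityʳ (ℤ.+ n))))

fromℕ-* : ∀ m n → fromℕ (m * n) ≡ fromℕ m ℚ.* fromℕ n
fromℕ-* m n rewrite fromℕ-mkℚ m | fromℕ-mkℚ n = cong (_/ 1) (ℤₚ.pos-* m n)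

fromℕ-mono-≤ : ∀ {m n} → m ≤ n → fromℕ m ℚ.≤ fromℕ n
fromℕ-mono-≤ {m} {n} m≤n rewrite fromℕ-mkℚ m | fromℕ-mkℚ n =
  ℚ.*≤* (ℤₚ.*-monoʳ-≤-nonNeg (ℤ.+ 1) (ℤ.+≤+ m≤n))

fromℕ-cancel-≤ : ∀ {m n} → fromℕ m ℚ.≤ fromℕ n → m ≤ n
fromℕ-cancel-≤ {m} {n} p rewrite fromℕ-mkℚ m | fromℕ-mkℚ n =
  ℤₚ.drop‿+≤+ (ℤₚ.*-cancelʳ-≤-pos (ℤ.+ m) (ℤ.+ n) (ℤ.+ 1) (ℚₚ.drop-*≤* p))

-- A denominator is at least 1, so a nonnegative numerator is already a bound; 0 serves for negative
-- `r`.
≤-fromℕ : ∀ r → ∃[ m ] r ℚ.≤ fromℕ m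
≤-fromℕ (mkℚ (ℤ.+ n) d-1 c) = n , subst (mkℚ (ℤ.+ n) d-1 c ℚ.≤_) (sym (fromℕ-mkℚ n))
  (ℚ.*≤* (subst₂ ℤ._≤_ (ℤₚ.pos-* n 1) (ℤₚ.pos-* n (suc d-1)) (ℤ.+≤+ (*-monoʳ-≤ n (s≤s z≤n)))))
≤-fromℕ (mkℚ ℤ.-[1+ n ] d-1 c) = 0 , ℚ.*≤* ℤ.-≤+

infixl 6 _⊞_
_⊞_ : Polynomial → Polynomial → Polynomial
[]      ⊞ q       = q
(c ∷ p) ⊞ []      = c ∷ p
(c ∷ p) ⊞ (b ∷ q) = c ℚ.+ b ∷ p ⊞ q

scale : ℚ → Polynomial → Polynomial
scale c = map (c ℚ.*_)

infixl 7 _⊠_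
-- With constants in a clause of their own, the recursive clause has a left factor of length at
-- least two, which makes the degree bound in `length-⊠` a successor.
_⊠_ : Polynomial → Polynomial → Polynomial
[]          ⊠ q = []
(c ∷ [])    ⊠ q = scale c q
(c ∷ p@(_ ∷ _)) ⊠ q = scale c q ⊞ (0ℚ ∷ p ⊠ q)

eval-⊞ : ∀ p q x → eval (p ⊞ q) x ≡ eval p x ℚ.+ eval q x
eval-⊞ []      q       x = sym (ℚₚ.+-identityˡ (eval q x))
eval-⊞ (c ∷ p) []      x = sym (ℚₚ.+-identityʳ _)
eval-⊞ (c ∷ p) (b ∷ q) x = trans (cong (λ z → c ℚ.+ b ℚ.+ x ℚ.* z) (eval-⊞ p q x))
  (solve 5 (λ c b x u v → (c :+ b) :+ x :* (u :+ v) := (c :+ x :* u) :+ (b :+ x :* v)) refl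
    c b x (eval p x) (eval q x))
  where open +-*-Solver

eval-scale : ∀ c p x → eval (scale c p) x ≡ c ℚ.* eval p x
eval-scale c []      x = sym (ℚₚ.*-zeroʳ c)
eval-scale c (b ∷ p) x = trans (cong (λ z → c ℚ.* b ℚ.+ x ℚ.* z) (eval-scale c p x))
  (solve 4 (λ c b x u → c :* b :+ x :* (c :* u) := c :* (b :+ x :* u)) refl c b x (eval p x))
  where open +-*-Solver

eval-⊠ : ∀ p q x → eval (p ⊠ q) x ≡ eval p x ℚ.* eval q x
eval-⊠ []       q x = sym (ℚₚ.*-zeroˡ (eval q x))
eval-⊠ (c ∷ []) q x = trans (eval-scale c q x)
  (solve 3 (λ c x v → c :* v := (c :+ x :* con 0ℚ) :* v) refl c x (eval q x))
  where open +-*-Solver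
eval-⊠ (c ∷ p@(_ ∷ _)) q x = trans (eval-⊞ (scale c q) (0ℚ ∷ p ⊠ q) x)
  (trans (cong₂ (λ y z → y ℚ.+ (0ℚ ℚ.+ x ℚ.* z)) (eval-scale c q x) (eval-⊠ p q x))
    (solve 4 (λ c x u v → c :* v :+ (con 0ℚ :+ x :* (u :* v)) := (c :+ x :* u) :* v) refl
      c x (eval p x) (eval q x)))
  where open +-*-Solver

length-⊞ : ∀ p q → length p ≤ d → length q ≤ d → length (p ⊞ q) ≤ d
length-⊞ []      q       _       q≤d     = q≤d
length-⊞ (c ∷ p) []      p≤d     _       = p≤d
length-⊞ (c ∷ p) (b ∷ q) (s≤s p≤d) (s≤s q≤d) = s≤s (length-⊞ p q p≤d q≤d)

length-⊠ : ∀ p q → length p ≤ suc d → length q ≤ suc e → length (p ⊠ q) ≤ suc (d + e)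
length-⊠ []       q _ _ = z≤n
length-⊠ {d} {e} (c ∷ []) q _ q≤ = ≤-trans (≤-reflexive (length-map (c ℚ.*_) q)) (≤-trans q≤ (s≤s (m≤n+m e d)))
length-⊠ {suc d} {e} (c ∷ p@(_ ∷ _)) q (s≤s p≤) q≤ = length-⊞ (scale c q) (0ℚ ∷ p ⊠ q)
  (≤-trans (≤-reflexive (length-map (c ℚ.*_) q)) (≤-trans q≤ (s≤s (m≤n+m e (suc d)))))
  (s≤s (length-⊠ p q p≤ q≤))

coeff-length : ∀ p i → length p ≤ i → coeff p i ≡ 0ℚ
coeff-length []      i       _         = refl
coeff-length (c ∷ p) (suc i) (s≤s p≤i) = coeff-length p i p≤i

eval-zero : ∀ p x → (∀ i → coeff p i ≡ 0ℚ) → eval p x ≡ 0ℚ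
eval-zero []      x p≡0 = refl
eval-zero (c ∷ p) x p≡0 rewrite p≡0 0 | eval-zero p x (p≡0 ∘ suc) =
  trans (ℚₚ.+-identityˡ _) (ℚₚ.*-zeroʳ x)

-- Horner's scheme bounds the constant term and the tail separately; the constant is raised by a
-- power of `q`, which is at least 1. The hypothesis concerns coefficients and not the length,
-- because it is applied to a list whose last coefficient is assumed to vanish.
eval-bound : ∀ p d → (∀ i → d < i → coeff p i ≡ 0ℚ) →
             ∃[ M ] (∀ q .{{_ : NonZero q}} → eval p (fromℕ q) ℚ.≤ fromℕ (M * q ^ d))
eval-bound []      d       _   = 0 , λ q → ℚₚ.≤-refl
eval-bound (c ∷ p) zero    p≡0 with M , c≤M ← ≤-fromℕ c = M , λ q → begin
  c ℚ.+ fromℕ q ℚ.* eval p (fromℕ q)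
    ≡⟨ cong (λ z → c ℚ.+ fromℕ q ℚ.* z) (eval-zero p (fromℕ q) (λ i → p≡0 (suc i) (s≤s z≤n))) ⟩
  c ℚ.+ fromℕ q ℚ.* 0ℚ  ≡⟨ trans (cong (c ℚ.+_) (ℚₚ.*-zeroʳ (fromℕ q))) (ℚₚ.+-identityʳ c) ⟩
  c                     ≤⟨ c≤M ⟩
  fromℕ M               ≡⟨ cong fromℕ (*-identityʳ M) ⟨
  fromℕ (M * 1)         ∎
  where open ℚₚ.≤-Reasoning
eval-bound (c ∷ p) (suc d) p≡0
  with M , c≤M ← ≤-fromℕ c
     | M′ , p≤M′ ← eval-bound p d (λ i d<i → p≡0 (suc i) (s≤s d<i)) = M + M′ , λ q → begin
  c ℚ.+ fromℕ q ℚ.* eval p (fromℕ q)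
    ≤⟨ ℚₚ.+-mono-≤ c≤M (ℚₚ.*-monoˡ-≤-nonNeg (fromℕ q) {{ℚₚ.normalize-nonNeg q 1}} (p≤M′ q)) ⟩
  fromℕ M ℚ.+ fromℕ q ℚ.* fromℕ (M′ * q ^ d)
    ≡⟨ cong (fromℕ M ℚ.+_) (fromℕ-* q (M′ * q ^ d)) ⟨
  fromℕ M ℚ.+ fromℕ (q * (M′ * q ^ d))
    ≡⟨ fromℕ-+ M (q * (M′ * q ^ d)) ⟨
  fromℕ (M + q * (M′ * q ^ d))
    ≤⟨ fromℕ-mono-≤ (+-mono-≤ (m≤m*n M (q ^ suc d) {{m^n≢0 q (suc d)}}) (≤-reflexive (swap q M′ (q ^ d)))) ⟩
  fromℕ (M * q ^ suc d + M′ * q ^ suc d)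
    ≡⟨ cong fromℕ (*-distribʳ-+ (q ^ suc d) M M′) ⟨
  fromℕ ((M + M′) * q ^ suc d) ∎
  where
  open ℚₚ.≤-Reasoning
  swap : ∀ a b c → a * (b * c) ≡ b * (a * c)
  swap a b c = trans (sym (*-assoc a b c)) (trans (cong (_* c) (*-comm a b)) (*-assoc b a c))

-- Functions given by polynomials of bounded degree

-- Here `d` only bounds the degree, so that sums with cancellation stay within the predicate.
IsPoly : ℕ → (ℕ → ℚ) → Set
IsPoly d f = ∃[ φ ] length φ ≤ suc d × (∀ s → f s ≡ eval φ (fromℕ s))

isPoly-cong : (∀ s → f s ≡ g s) → IsPoly d f → IsPoly d g
isPoly-cong f≡g (φ , len , ev) = φ , len , λ s → trans (sym (f≡g s)) (ev s)

isPoly-mono : d ≤ e → IsPoly d f → IsPoly e f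
isPoly-mono d≤e (φ , len , ev) = φ , ≤-trans len (s≤s d≤e) , ev

isPoly-const : ∀ c → IsPoly 0 (λ _ → c)
isPoly-const c = c ∷ [] , ≤-refl , λ s → sym (trans (cong (c ℚ.+_) (ℚₚ.*-zeroʳ (fromℕ s))) (ℚₚ.+-identityʳ c))

isPoly-fromℕ : IsPoly 1 fromℕ
isPoly-fromℕ = 0ℚ ∷ 1ℚ ∷ [] , ≤-refl , λ s → solve 1 (λ x → x := con 0ℚ :+ x :* (con 1ℚ :+ x :* con 0ℚ)) refl (fromℕ s)
  where open +-*-Solver

isPoly-+ : IsPoly d f → IsPoly d g → IsPoly d (λ s → f s ℚ.+ g s)
isPoly-+ (φ , lenφ , evφ) (ψ , lenψ , evψ) =
  φ ⊞ ψ , length-⊞ φ ψ lenφ lenψ , λ s → trans (cong₂ ℚ._+_ (evφ s) (evψ s)) (sym (eval-⊞ φ ψ (fromℕ s)))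

isPoly-* : IsPoly d f → IsPoly e g → IsPoly (d + e) (λ s → f s ℚ.* g s)
isPoly-* (φ , lenφ , evφ) (ψ , lenψ , evψ) =
  φ ⊠ ψ , length-⊠ φ ψ lenφ lenψ , λ s → trans (cong₂ ℚ._*_ (evφ s) (evψ s)) (sym (eval-⊠ φ ψ (fromℕ s)))

isPoly-scale : ∀ c → IsPoly d f → IsPoly d (λ s → c ℚ.* f s)
isPoly-scale c = isPoly-* (isPoly-const c)

isPoly-- : IsPoly d f → IsPoly d g → IsPoly d (λ s → f s ℚ.- g s)
isPoly-- {f = f} {g = g} pf pg = isPoly-cong
  (λ s → solve 2 (λ x y → x :+ con (ℚ.- 1ℚ) :* y := x :- y) refl (f s) (g s))
  (isPoly-+ pf (isPoly-scale (ℚ.- 1ℚ) pg))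
  where open +-*-Solver

-- By absorption, passing from `a` to `suc a` multiplies by the linear factor (s + a + 1) / (a + 1).
multichoose-isPoly : ∀ a → IsPoly a (λ s → fromℕ (multichoose a s))
multichoose-isPoly zero    = isPoly-const (fromℕ 1)
multichoose-isPoly (suc a) = isPoly-cong eq
  (isPoly-scale (ℚ.1/ A) (isPoly-* (isPoly-+ isPoly-fromℕ (isPoly-mono z≤n (isPoly-const A))) (multichoose-isPoly a)))
  where
  A = fromℕ (suc a)
  instance
    A≢0 : ℚ.NonZero A
    A≢0 = ℚₚ.pos⇒nonZero A {{ℚₚ.normalize-pos (suc a) 1}}
  eq : ∀ s → ℚ.1/ A ℚ.* ((fromℕ s ℚ.+ A) ℚ.* fromℕ (multichoose a s)) ≡ fromℕ (multichoose (suc a) s)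
  eq s = begin
    ℚ.1/ A ℚ.* ((fromℕ s ℚ.+ A) ℚ.* fromℕ (multichoose a s))
      ≡⟨ cong (λ z → ℚ.1/ A ℚ.* (z ℚ.* fromℕ (multichoose a s))) (trans (sym (fromℕ-+ s (suc a))) (cong fromℕ (+-suc s a))) ⟩
    ℚ.1/ A ℚ.* (fromℕ (suc (s + a)) ℚ.* fromℕ (multichoose a s))
      ≡⟨ cong (ℚ.1/ A ℚ.*_) (trans (sym (fromℕ-* (suc (s + a)) (multichoose a s)))
           (trans (cong fromℕ (sym (multichoose-absorb a s))) (fromℕ-* (suc a) (multichoose (suc a) s)))) ⟩
    ℚ.1/ A ℚ.* (A ℚ.* fromℕ (multichoose (suc a) s))
      ≡⟨ ℚₚ.*-assoc (ℚ.1/ A) A _ ⟨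
    ℚ.1/ A ℚ.* A ℚ.* fromℕ (multichoose (suc a) s)
      ≡⟨ cong (ℚ._* fromℕ (multichoose (suc a) s)) (ℚₚ.*-inverseˡ A) ⟩
    1ℚ ℚ.* fromℕ (multichoose (suc a) s)
      ≡⟨ ℚₚ.*-identityˡ _ ⟩
    fromℕ (multichoose (suc a) s) ∎
    where open ≡-Reasoning

downs-∷ : ∀ a w → downs a ++ down ∷ w ≡ downs (suc a) ++ w
downs-∷ zero    w = refl
downs-∷ (suc a) w = cong (down ∷_) (downs-∷ a w)

-- The word is scanned from the left with a block of `down` collected in front, and each `up` is
-- exchanged by `total-flip`. Both factors of the product term have degree bound one above their
-- length, which makes up exactly for the letter removed.
total-isPoly : ∀ w a → IsPoly (suc (a + length w)) (λ s → fromℕ (total (suc s) (downs a ++ w)))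
total-isPoly [] a = isPoly-cong
  (λ s → cong fromℕ (trans (sym (total-downs a s)) (cong (total (suc s)) (sym (++-identityʳ (downs a))))))
  (isPoly-mono (≤-reflexive (cong suc (sym (+-identityʳ a)))) (multichoose-isPoly (suc a)))
total-isPoly (down ∷ w) a = isPoly-cong (λ s → cong (fromℕ ∘ total (suc s)) (sym (downs-∷ a w)))
  (isPoly-mono (≤-reflexive (cong suc (sym (+-suc a (length w))))) (total-isPoly w (suc a)))
total-isPoly (up ∷ w) a = isPoly-cong eq
  (isPoly-- (isPoly-+
    (isPoly-mono (s≤s (+-monoʳ-≤ a (n≤1+n (length w)))) (total-isPoly w a))
    (isPoly-* (multichoose-isPoly (suc a)) (total-isPoly w 0)))
    (isPoly-mono (≤-reflexive (cong suc (sym (+-suc a (length w))))) (total-isPoly w (suc a))))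
  where
  eq : ∀ s → fromℕ (total (suc s) (downs a ++ w)) ℚ.+ fromℕ (multichoose (suc a) s) ℚ.* fromℕ (total (suc s) w)
               ℚ.- fromℕ (total (suc s) (downs (suc a) ++ w))
           ≡ fromℕ (total (suc s) (downs a ++ up ∷ w))
  eq s = begin
    T (downs a ++ w) ℚ.+ fromℕ (multichoose (suc a) s) ℚ.* T w ℚ.- T (downs (suc a) ++ w)
      ≡⟨ cong (λ z → T (downs a ++ w) ℚ.+ z ℚ.- T (downs (suc a) ++ w))
           (trans (sym (fromℕ-* (multichoose (suc a) s) (total (suc s) w)))
                  (cong (λ z → fromℕ (z * total (suc s) w)) (sym (total-downs a s)))) ⟩
    T (downs a ++ w) ℚ.+ fromℕ (total (suc s) (downs a) * total (suc s) w) ℚ.- T (downs (suc a) ++ w)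
      ≡⟨ cong (ℚ._- T (downs (suc a) ++ w)) (trans (sym (fromℕ-+ (total (suc s) (downs a ++ w)) _))
           (trans (cong fromℕ (sym (total-flip (suc s) (downs a) up w)))
                  (fromℕ-+ (total (suc s) (downs a ++ up ∷ w)) _))) ⟩
    T (downs a ++ up ∷ w) ℚ.+ T (downs a ++ down ∷ w) ℚ.- T (downs (suc a) ++ w)
      ≡⟨ cong (λ z → T (downs a ++ up ∷ w) ℚ.+ T z ℚ.- T (downs (suc a) ++ w)) (downs-∷ a w) ⟩
    T (downs a ++ up ∷ w) ℚ.+ T (downs (suc a) ++ w) ℚ.- T (downs (suc a) ++ w)
      ≡⟨ solve 2 (λ x y → x :+ y :- y := x) refl (T (downs a ++ up ∷ w)) (T (downs (suc a) ++ w)) ⟩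
    T (downs a ++ up ∷ w) ∎
    where
    open ≡-Reasoning
    open +-*-Solver
    T : Word → ℚ
    T v = fromℕ (total (suc s) v)

-- Quasi-polynomiality and the degree

sign : ℕ → ℚ
sign zero    = 1ℚ
sign (suc s) = ℚ.- sign s

-- The first argument is Σ k, the second the length of the cycle.
amplitude : ℕ → ℕ → ℚ
amplitude zero    zero          = 0ℚ
amplitude zero    (suc zero)    = ½
amplitude zero    (suc (suc n)) = amplitude zero n
amplitude (suc k) n             = ½ ℚ.* amplitude k n

amplitude-period : ∀ k n → amplitude k (2 + n) ≡ amplitude k n
amplitude-period zero    n = refl
amplitude-period (suc k) n = cong (½ ℚ.*_) (amplitude-period k n)

amplitude-0 : ∀ k → amplitude k 0 ≡ 0ℚ
amplitude-0 zero    = refl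
amplitude-0 (suc k) = trans (cong (½ ℚ.*_) (amplitude-0 k)) (ℚₚ.*-zeroʳ ½)

-- The oscillating part is prescribed, so inductions keep track of its exact value. The maximum with
-- 1 accounts for even `n`, where the empty word has trace s + 1.
QuasiPoly : ℕ → ℕ → (ℕ → ℕ) → Set
QuasiPoly n k F = IsPoly (1 ⊔ k) (λ s → fromℕ (F s) ℚ.- sign s ℚ.* amplitude k n)

trace : ℕ → Word → ℕ → ℕ
trace n w s = twistedTrace (suc s) n w

trace-downs-quasiPoly : ∀ a → QuasiPoly 0 a (trace 0 (downs a))
trace-downs-quasiPoly a = isPoly-cong eq
  (isPoly-mono (m≤m⊔n 1 a) (isPoly-+ (isPoly-mono z≤n (isPoly-const 1ℚ)) isPoly-fromℕ))
  where
  eq : ∀ s → 1ℚ ℚ.+ fromℕ s ≡ fromℕ (trace 0 (downs a) s) ℚ.- sign s ℚ.* amplitude a 0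
  eq s rewrite trace-downs (suc s) a | amplitude-0 a | fromℕ-+ 1 s =
    solve 2 (λ x y → x := x :- y :* con 0ℚ) refl (1ℚ ℚ.+ fromℕ s) (sign s)
    where open +-*-Solver

isEven-sign : ∀ s → ½ ≡ fromℕ (isEven s) ℚ.- sign s ℚ.* ½
isEven-sign zero          = refl
isEven-sign (suc zero)    = refl
isEven-sign (suc (suc s)) = trans (isEven-sign s)
  (cong (λ x → fromℕ (isEven s) ℚ.- x ℚ.* ½) (sym (neg-involutive (sign s))))

-- Solving `trace-reflect-downs` for the longer word halves the oscillating part, as `amplitude`
-- does with each letter, and adds only a polynomial.
trace-reflect-downs-quasiPoly : ∀ a → QuasiPoly 1 a (trace 1 (downs a))
trace-reflect-downs-quasiPoly zero = isPoly-cong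
  (λ s → trans (isEven-sign s) (cong (λ m → fromℕ m ℚ.- sign s ℚ.* ½) (sym (trace-reflect-[] s))))
  (isPoly-mono z≤n (isPoly-const ½))
trace-reflect-downs-quasiPoly (suc a) = isPoly-cong eq
  (isPoly-scale ½ (isPoly-+
    (isPoly-mono (⊔-lub (s≤s z≤n) (n≤1+n a)) (trace-reflect-downs-quasiPoly a))
    (multichoose-isPoly (suc a))))
  where
  eq : ∀ s → ½ ℚ.* (fromℕ (trace 1 (downs a) s) ℚ.- sign s ℚ.* amplitude a 1 ℚ.+ fromℕ (multichoose (suc a) s))
           ≡ fromℕ (trace 1 (downs (suc a)) s) ℚ.- sign s ℚ.* (½ ℚ.* amplitude a 1)
  eq s = begin
    ½ ℚ.* (T a ℚ.- σ ℚ.* A ℚ.+ M)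
      ≡⟨ solve 4 (λ t σ A m → con ½ :* ((t :- σ :* A) :+ m) := con ½ :* (t :+ m) :- σ :* (con ½ :* A)) refl (T a) σ A M ⟩
    ½ ℚ.* (T a ℚ.+ M) ℚ.- σ ℚ.* (½ ℚ.* A)
      ≡⟨ cong (λ z → ½ ℚ.* z ℚ.- σ ℚ.* (½ ℚ.* A)) (begin
           T a ℚ.+ M ≡⟨ fromℕ-+ (trace 1 (downs a) s) (multichoose (suc a) s) ⟨
           fromℕ (trace 1 (downs a) s + multichoose (suc a) s)
             ≡⟨ cong (λ z → fromℕ (trace 1 (downs a) s + z)) (total-downs a s) ⟨
           fromℕ (trace 1 (downs a) s + total (suc s) (downs a))
             ≡⟨ cong fromℕ (trace-reflect-downs (suc s) a) ⟨
           fromℕ (trace 1 (downs (suc a)) s + trace 1 (downs (suc a)) s)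
             ≡⟨ fromℕ-+ (trace 1 (downs (suc a)) s) (trace 1 (downs (suc a)) s) ⟩
           T (suc a) ℚ.+ T (suc a) ∎) ⟩
    ½ ℚ.* (T (suc a) ℚ.+ T (suc a)) ℚ.- σ ℚ.* (½ ℚ.* A)
      ≡⟨ solve 2 (λ t u → con ½ :* (t :+ t) :- u := t :- u) refl (T (suc a)) (σ ℚ.* (½ ℚ.* A)) ⟩
    T (suc a) ℚ.- σ ℚ.* (½ ℚ.* A) ∎
    where
    open ≡-Reasoning
    open +-*-Solver
    T : ℕ → ℚ
    T a = fromℕ (trace 1 (downs a) s)
    M = fromℕ (multichoose (suc a) s)
    A = amplitude a 1
    σ = sign s

++-downs-∷ʳ : ∀ w a → (w ++ downs a) ∷ʳ down ≡ w ++ downs (suc a)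
++-downs-∷ʳ w a = trans (++-assoc w (downs a) (down ∷ [])) (cong (w ++_) (replicate-∷ʳ a down))

-- The first letter is rotated to the back. If it arrives there as `down`, it joins the trailing
-- block; if it would arrive as `up`, it is exchanged at the front first, and its flip arrives as
-- `down`. The induction is on `w` for all `a` at once.
trace-++-downs-quasiPoly : ∀ n → (∀ a → QuasiPoly n a (trace n (downs a))) →
  ∀ w a → QuasiPoly n (length w + a) (trace n (w ++ downs a))
trace-++-downs-quasiPoly n base []      a = base a
trace-++-downs-quasiPoly n base (x ∷ w) a = cases (flips n x) refl
  where
  v = w ++ downs a
  k = length w + a

  rotated : QuasiPoly n (suc k) (trace n (v ∷ʳ down))
  rotated = subst₂ (λ K u → QuasiPoly n K (trace n u)) (+-suc (length w) a) (sym (++-downs-∷ʳ w a))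
    (trace-++-downs-quasiPoly n base w (suc a))

  eq : ∀ s → flips n x ≡ up →
    fromℕ (trace n v s) ℚ.- sign s ℚ.* amplitude k n ℚ.+ fromℕ (total (suc s) v)
      ℚ.- (fromℕ (trace n (v ∷ʳ down) s) ℚ.- sign s ℚ.* (½ ℚ.* amplitude k n))
    ≡ fromℕ (trace n (x ∷ v) s) ℚ.- sign s ℚ.* (½ ℚ.* amplitude k n)
  eq s x-up = begin
    t ℚ.- σ ℚ.* A ℚ.+ p ℚ.- (r ℚ.- σ ℚ.* (½ ℚ.* A))
      -- The shorter word has amplitude `A` and the rotated one half of it; their difference is the
      -- half of `A` required for one more letter.
      ≡⟨ solve 5 (λ t σ A p r → (t :- σ :* A) :+ p :- (r :- σ :* (con ½ :* A)) :=
                                (t :+ p) :- r :- σ :* (con ½ :* A)) refl t σ A p r ⟩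
    t ℚ.+ p ℚ.- r ℚ.- σ ℚ.* (½ ℚ.* A)
      ≡⟨ cong (λ z → z ℚ.- r ℚ.- σ ℚ.* (½ ℚ.* A)) (begin
           t ℚ.+ p ≡⟨ fromℕ-+ (trace n v s) (total (suc s) v) ⟨
           fromℕ (trace n v s + total (suc s) v) ≡⟨ cong fromℕ (twistedTrace-flip (suc s) n x v) ⟨
           fromℕ (trace n (x ∷ v) s + trace n (flip x ∷ v) s)
             ≡⟨ cong (λ z → fromℕ (trace n (x ∷ v) s + z)) (trans (twistedTrace-rotate (suc s) n (flip x) v)
                  (cong (λ y → trace n (v ∷ʳ y) s) (trans (flips-flip n x) (cong flip x-up)))) ⟩
           fromℕ (trace n (x ∷ v) s + trace n (v ∷ʳ down) s)
             ≡⟨ fromℕ-+ (trace n (x ∷ v) s) (trace n (v ∷ʳ down) s) ⟩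
           y ℚ.+ r ∎) ⟩
    y ℚ.+ r ℚ.- r ℚ.- σ ℚ.* (½ ℚ.* A)
      ≡⟨ solve 3 (λ y r z → y :+ r :- r :- z := y :- z) refl y r (σ ℚ.* (½ ℚ.* A)) ⟩
    y ℚ.- σ ℚ.* (½ ℚ.* A) ∎
    where
    open ≡-Reasoning
    open +-*-Solver
    t = fromℕ (trace n v s)
    p = fromℕ (total (suc s) v)
    r = fromℕ (trace n (v ∷ʳ down) s)
    y = fromℕ (trace n (x ∷ v) s)
    A = amplitude k n
    σ = sign s

  length-v : length v ≡ k
  length-v = trans (length-++ w) (cong (λ l → length w + l) (length-replicate a))

  cases : ∀ y → flips n x ≡ y → QuasiPoly n (suc k) (trace n (x ∷ v))
  cases down x-down = isPoly-cong (λ s → cong (λ z → fromℕ z ℚ.- sign s ℚ.* amplitude (suc k) n)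
    (sym (trans (twistedTrace-rotate (suc s) n x v) (cong (λ y → trace n (v ∷ʳ y) s) x-down)))) rotated
  cases up x-up = isPoly-cong (λ s → eq s x-up)
    (isPoly-- (isPoly-+
      (isPoly-mono (⊔-lub (s≤s z≤n) (n≤1+n k)) (trace-++-downs-quasiPoly n base w a))
      (isPoly-mono (≤-reflexive (cong suc length-v)) (total-isPoly v 0)))
      rotated)

trace-quasiPoly : ∀ n w → QuasiPoly n (length w) (trace n w)
trace-quasiPoly zero       w = subst₂ (λ k v → QuasiPoly 0 k (trace 0 v)) (+-identityʳ (length w)) (++-identityʳ w)
  (trace-++-downs-quasiPoly 0 trace-downs-quasiPoly w 0)
trace-quasiPoly (suc zero) w = subst₂ (λ k v → QuasiPoly 1 k (trace 1 v)) (+-identityʳ (length w)) (++-identityʳ w)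
  (trace-++-downs-quasiPoly 1 trace-reflect-downs-quasiPoly w 0)
trace-quasiPoly (suc (suc n)) w = isPoly-cong
  (λ s → sym (cong₂ (λ t A → fromℕ t ℚ.- sign s ℚ.* A)
    (twistedTrace-period (suc s) n w) (amplitude-period (length w) n)))
  (trace-quasiPoly n w)

-- The oscillating term in closed form

half-/ : ∀ z c .{{_ : NonZero c}} .{{_ : NonZero (2 * c)}} → ½ ℚ.* (z / c) ≡ z / (2 * c)
half-/ z c@(suc c-1) = ℚₚ.toℚᵘ-injective (begin
  ℚ.toℚᵘ (½ ℚ.* (z / c))              ≈⟨ ℚₚ.toℚᵘ-homo-* ½ (z / c) ⟩
  ℚ.toℚᵘ ½ ℚᵘ.* ℚ.toℚᵘ (z / c)        ≈⟨ ℚᵘₚ.*-congˡ {ℚ.toℚᵘ ½} (ℚₚ.toℚᵘ-fromℚᵘ (ℚᵘ.mkℚᵘ z c-1)) ⟩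
  -- Before normalisation both sides are the same fraction; `c-1 + (c + 0)` encodes the denominator
  -- `2 * c`, being one less.
  ℚ.toℚᵘ ½ ℚᵘ.* ℚᵘ.mkℚᵘ z c-1         ≡⟨ cong (λ y → ℚᵘ.mkℚᵘ y (c-1 + (c + 0))) (ℤₚ.*-identityˡ z) ⟩
  ℚᵘ.mkℚᵘ z (c-1 + (c + 0))           ≈⟨ ℚₚ.toℚᵘ-fromℚᵘ (ℚᵘ.mkℚᵘ z (c-1 + (c + 0))) ⟨
  ℚ.toℚᵘ (z / (2 * c))                ∎)
  where open import Relation.Binary.Reasoning.Setoid ℚᵘₚ.≃-setoid

sign-cases : ∀ s → (sign s ≡ 1ℚ × -1ℤ ℤ.^ s ≡ 1ℤ) ⊎ (sign s ≡ ℚ.- 1ℚ × -1ℤ ℤ.^ s ≡ -1ℤ)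
sign-cases zero = inj₁ (refl , refl)
sign-cases (suc s) with sign-cases s
... | inj₁ (p , q) rewrite p | q = inj₂ (refl , refl)
... | inj₂ (p , q) rewrite p | q = inj₁ (refl , refl)

amplitude-cases : ∀ n → (amplitude 0 n ≡ 0ℚ × -1ℤ ℤ.^ (n + 1) ≡ -1ℤ) ⊎ (amplitude 0 n ≡ ½ × -1ℤ ℤ.^ (n + 1) ≡ 1ℤ)
amplitude-cases zero = inj₁ (refl , refl)
amplitude-cases (suc zero) = inj₂ (refl , refl)
amplitude-cases (suc (suc n)) with amplitude-cases n
... | inj₁ (p , q) rewrite q = inj₁ (p , refl)
... | inj₂ (p , q) rewrite q = inj₂ (p , refl)

sign-amplitude : ∀ s k n → sign s ℚ.* amplitude k n ≡
  _/_ ((-1ℤ ℤ.^ s) ℤ.* (1ℤ ℤ.+ (-1ℤ ℤ.^ (n + 1)))) (2 ^ (k + 2)) {{m^n≢0 2 (k + 2)}}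
-- The denominator is 4 and the numerator is 0, 2 or -2, so each case is a closed computation.
sign-amplitude s zero n with sign-cases s | amplitude-cases n
... | inj₁ (p , q) | inj₁ (p′ , q′) rewrite p | q | p′ | q′ = refl
... | inj₁ (p , q) | inj₂ (p′ , q′) rewrite p | q | p′ | q′ = refl
... | inj₂ (p , q) | inj₁ (p′ , q′) rewrite p | q | p′ | q′ = refl
... | inj₂ (p , q) | inj₂ (p′ , q′) rewrite p | q | p′ | q′ = refl
sign-amplitude s (suc k) n = begin
  sign s ℚ.* (½ ℚ.* amplitude k n)
    ≡⟨ solve 3 (λ x y z → x :* (y :* z) := y :* (x :* z)) refl (sign s) ½ (amplitude k n) ⟩
  ½ ℚ.* (sign s ℚ.* amplitude k n) ≡⟨ cong (½ ℚ.*_) (sign-amplitude s k n) ⟩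
  ½ ℚ.* (_/_ z (2 ^ (k + 2)) {{m^n≢0 2 (k + 2)}})
    ≡⟨ half-/ z (2 ^ (k + 2)) {{m^n≢0 2 (k + 2)}} {{m^n≢0 2 (suc k + 2)}} ⟩
  _/_ z (2 ^ (suc k + 2)) {{m^n≢0 2 (suc k + 2)}} ∎
  where
  open ≡-Reasoning
  open +-*-Solver
  z = (-1ℤ ℤ.^ s) ℤ.* (1ℤ ℤ.+ (-1ℤ ℤ.^ (n + 1)))

-- Growth and the leading coefficient

^-distribʳ-* : ∀ d m n → (m * n) ^ d ≡ m ^ d * n ^ d
^-distribʳ-* zero    m n = refl
^-distribʳ-* (suc d) m n = trans (cong (m * n *_) (^-distribʳ-* d m n)) ([m*n]*[o*p]≡[m*o]*[n*p] m n (m ^ d) (n ^ d))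

sign-even : ∀ t → sign (t * 2) ≡ 1ℚ
sign-even zero    = refl
sign-even (suc t) = trans (neg-involutive (sign (t * 2))) (sign-even t)

growth-contradiction : ∀ (f : ℕ → ℕ) d M r → (∀ q .{{_ : NonZero q}} → q ^ suc d ≤ f q) →
                       ¬ (∀ q .{{_ : NonZero q}} → f q ≤ M * (r * q) ^ d)
growth-contradiction f d M r lower upper =
  -- At q = `suc B` the two bounds would give `suc B ^ suc d ≤ B * suc B ^ d`.
  1+n≰n (*-cancelʳ-≤ (suc B) B (suc B ^ d) {{m^n≢0 (suc B) d}} (begin
    suc B ^ suc d           ≤⟨ lower (suc B) ⟩
    f (suc B)               ≤⟨ upper (suc B) ⟩
    M * (r * suc B) ^ d     ≡⟨ cong (M *_) (^-distribʳ-* d r (suc B)) ⟩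
    M * (r ^ d * suc B ^ d) ≡⟨ *-assoc M (r ^ d) (suc B ^ d) ⟨
    B * suc B ^ d           ∎))
  where
  open ≤-Reasoning
  B = M * r ^ d

-- At even arguments the sign is 1, so the oscillating part is a constant and fits under the same
-- power bound.
even-upper : ∀ (F : ℕ → ℕ) d φ c → (∀ i → d < i → coeff φ i ≡ 0ℚ) →
  (∀ s → fromℕ (F s) ≡ eval φ (fromℕ s) ℚ.+ sign s ℚ.* c) →
  ∃[ M ] (∀ t .{{_ : NonZero (t * 2)}} → F (t * 2) ≤ M * (t * 2) ^ d)
even-upper F d φ c φ≡0 F≡
  with M₁ , φ≤M₁ ← eval-bound φ d φ≡0
     | M₂ , c≤M₂ ← ≤-fromℕ c = M₁ + M₂ , λ t → fromℕ-cancel-≤ (begin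
  fromℕ (F (t * 2)) ≡⟨ F≡ (t * 2) ⟩
  eval φ (fromℕ (t * 2)) ℚ.+ sign (t * 2) ℚ.* c
    ≡⟨ cong (eval φ (fromℕ (t * 2)) ℚ.+_) (trans (cong (ℚ._* c) (sign-even t)) (ℚₚ.*-identityˡ c)) ⟩
  eval φ (fromℕ (t * 2)) ℚ.+ c        ≤⟨ ℚₚ.+-mono-≤ (φ≤M₁ (t * 2)) c≤M₂ ⟩
  fromℕ (M₁ * (t * 2) ^ d) ℚ.+ fromℕ M₂ ≡⟨ fromℕ-+ (M₁ * (t * 2) ^ d) M₂ ⟨
  fromℕ (M₁ * (t * 2) ^ d + M₂)
    ≤⟨ fromℕ-mono-≤ (+-monoʳ-≤ (M₁ * (t * 2) ^ d) (m≤m*n M₂ ((t * 2) ^ d) {{m^n≢0 (t * 2) d}})) ⟩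
  fromℕ (M₁ * (t * 2) ^ d + M₂ * (t * 2) ^ d)
    ≡⟨ cong fromℕ (*-distribʳ-+ ((t * 2) ^ d) M₁ M₂) ⟨
  fromℕ ((M₁ + M₂) * (t * 2) ^ d)     ∎)
  where open ℚₚ.≤-Reasoning

-- If this coefficient vanished, `F` would grow at most with order `d` along the even numbers. The
-- arguments `K * q * 2` are even and large enough for the lower bound of order `suc d`, a
-- contradiction.
leading-coeff-nonzero : ∀ (F : ℕ → ℕ) K d φ c .{{_ : NonZero K}} →
  (∀ s q .{{_ : NonZero q}} → K * q ≤ s → q ^ suc d ≤ F s) → length φ ≤ suc (suc d) →
  (∀ s → fromℕ (F s) ≡ eval φ (fromℕ s) ℚ.+ sign s ℚ.* c) → coeff φ (suc d) ≢ 0ℚ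
leading-coeff-nonzero F K d φ c lower len F≡ lead≡0 =
  let M , upper = even-upper F d φ c coeff≡0 F≡ in
  growth-contradiction (λ q → F (K * q * 2)) d M (K * 2)
    (λ q → lower (K * q * 2) q (m≤m*n (K * q) 2))
    (λ q → subst (λ z → F (K * q * 2) ≤ M * z ^ d) (rearrange K q)
             (upper (K * q) {{m*n≢0 (K * q) 2 {{m*n≢0 K q}}}}))
  where
  rearrange : ∀ K q → K * q * 2 ≡ K * 2 * q
  rearrange = solve-∀
  coeff≡0 : ∀ i → d < i → coeff φ i ≡ 0ℚ
  coeff≡0 i d<i with m≤n⇒m<n∨m≡n d<i
  ... | inj₁ d<i-1 = coeff-length φ i (≤-trans len d<i-1)
  ... | inj₂ refl  = lead≡0

h-quasiPoly : ∀ {n} (k : Vec ℕ (suc n)) → QuasiPoly (suc n) (sum k) (h k)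
h-quasiPoly {n} k = isPoly-cong
  (λ s → cong (λ m → fromℕ m ℚ.- sign s ℚ.* amplitude (sum k) (suc n)) (sym (h≡twistedTrace s k)))
  (subst (λ K → QuasiPoly (suc n) K (trace (suc n) (word k))) (length-word k) (trace-quasiPoly (suc n) (word k)))

theorem1p5 : (n : ℕ) .{{_ : NonZero n}} (k : Vec ℕ n) → All NonZero k →
    ∃[ φ ] HasDegree φ (sum k) ×
    ((s : ℕ) .{{_ : NonZero s}} →
    fromℕ (h k s) ≡
    eval φ (fromℕ s) ℚ.+
    _/_ ((-1ℤ ℤ.^ s) ℤ.* (1ℤ ℤ.+ (-1ℤ ℤ.^ (n + 1))))
    (2 ^ (sum k + 2)) {{m^n≢0 2 (sum k + 2)}})
theorem1p5 (suc n) (zero ∷ _) (record { nonZero = () } ∷ _)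
-- The first entry being a successor, so is `sum k`: its predecessor is `k₁ + sum ks`, and
-- `1 ⊔ sum k` reduces to `sum k`.
theorem1p5 (suc n) k@(suc k₁ ∷ ks) k≢0 =
  let φ , len , φ≡ = h-quasiPoly k
      h≡ = λ s → move (fromℕ (h k s)) (sign s ℚ.* amplitude (sum k) (suc n)) (eval φ (fromℕ s)) (φ≡ s)
  in φ , (leading-coeff-nonzero (h k) (2 + sum k) (k₁ + sum ks) φ (amplitude (sum k) (suc n))
           (λ s q → h-lower s q k k≢0) len h≡
         , λ i k<i → coeff-length φ i (≤-trans len k<i))
       , λ s → trans (h≡ s) (cong (eval φ (fromℕ s) ℚ.+_) (sign-amplitude s (sum k) (suc n)))
  where
  move : ∀ x y z → x ℚ.- y ≡ z → x ≡ z ℚ.+ y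
  move x y z refl = solve 2 (λ x y → x := x :- y :+ y) refl x y
    where open +-*-Solver
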